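{- For any graphs $F$ and $H$, we have $\mathrm{rex}(n,H,F)=\Theta(n^{|V(H)|})$ (as $n\to\infty$, with $F$ and $H$ fixed) if and only if $F$ is not a subgraph of a blow-up of $H$ (that is, there is no blow-up of $H$ containing $F$ as a subgraph).
   Context: All graphs are finite and simple. $\mathcal{N}(H,G)$ denotes the number of (not necessarily induced) copies of $H$ in $G$. A graph is $F$-free if it does not contain $F$ as a (not necessarily induced) subgraph. For graphs $H,F$ and a positive integer $n$, $\mathrm{rex}(n,H,F):=\max\{\mathcal{N}(H,G): G \text{ is an } F\text{ -free regular } n\text{ -vertex graph}\}$. A blow-up of $H$ is a graph obtained by replacing each vertex of $H$ by an independent set of vertices and each edge $uv\in E(H)$ by a complete bipartite graph between the independent sets replacing $u$ and $v$. -}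

module Defs where

open import Data.Bool.Base using (true; false)
import Data.Bool.Properties as Bool
open import Data.Fin.Base using (Fin)
open import Data.Fin.Properties using (_≟_; any?; all?)
open import Data.Fin.Subset using (Subset; _∈_; ∣_∣)
open import Data.Fin.Subset.Properties using (_∈?_)
open import Data.List.Base
  using (List; []; _∷_; map; mapMaybe; filter; deduplicate; length; allFin; cartesianProductWith)
open import Data.List.Extrema.Nat using (max)
import Data.List.Membership.Propositional as List
import Data.List.Membership.Propositional.Properties as List
import Data.List.Relation.Unary.Any as Any
import Data.Maybe.Base as Maybe
open import Data.Nat.Base using (ℕ; zero; suc; _*_; _≤_)
import Data.Nat.Properties as ℕ
open import Data.Product.Base using (Σ; ∃-syntax; _×_; _,_)
import Data.Product.Properties as Product
open import Data.Vec.Base as Vec using (Vec; []; _∷_; lookup; tabulate)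
open import Data.Vec.Properties using (lookup∘tabulate)
import Data.Vec.Properties as Vec
open import Function.Base using (_∘_)
open import Function.Definitions using (Injective)
open import Level using (0ℓ)
open import Relation.Binary.Core using (Rel; _Preserves_⟶_)
open import Relation.Binary.Definitions using (DecidableEquality)
open import Relation.Binary.PropositionalEquality
  using (_≡_; refl; sym; trans; subst₂)
open import Relation.Nullary.Decidable.Core
  using (Dec; does; map′; dec⇒maybe; ¬?; _×-dec_; _→-dec_)
open import Relation.Nullary.Negation.Core using (¬_)
open import Relation.Unary using (Pred; Decidable)

------------------------------------------------------------------------
-- Finite simple graphs

-- Row u of the matrix is the neighbourhood of u.
Matrix : ℕ → Set
Matrix n = Vec (Subset n) n

Simple : ∀ {n} → Matrix n → Set
Simple M = (∀ u v → v ∈ lookup M u → u ∈ lookup M v)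
         × (∀ v → ¬ (v ∈ lookup M v))

record Graph (n : ℕ) : Set where
  constructor graph
  field
    neighbours : Matrix n
    simple     : Simple neighbours

  Adj : Rel (Fin n) 0ℓ
  Adj u v = v ∈ lookup neighbours u

  adj? : ∀ u v → Dec (Adj u v)
  adj? u v = v ∈? lookup neighbours u

  degree : Fin n → ℕ
  degree v = ∣ lookup neighbours v ∣

open Graph public

Regular : ∀ {n} → Graph n → Set
Regular G = ∀ u v → degree G u ≡ degree G v

regular? : ∀ {n} (G : Graph n) → Dec (Regular G)
regular? G = all? λ u → all? λ v → degree G u ℕ.≟ degree G v

------------------------------------------------------------------------
-- Not necessarily induced subgraphs

-- Stated for arbitrary adjacency relations, so that it also applies to
-- blow-ups, whose vertices are not of the form Fin n.
IsEmbedding : ∀ {A B : Set} → Rel A 0ℓ → Rel B 0ℓ → (A → B) → Set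
IsEmbedding R S φ = Injective _≡_ _≡_ φ × φ Preserves R ⟶ S

Contains : ∀ {A B : Set} → Rel B 0ℓ → Rel A 0ℓ → Set
Contains S R = ∃[ φ ] IsEmbedding R S φ

Free : ∀ {f n} → Graph f → Graph n → Set
Free F G = ¬ Contains (Adj G) (Adj F)

-- The parts may have different sizes; distinct vertices of the same part
-- are not adjacent because Adj H is irreflexive.
BlowUp : ∀ {h} → Graph h → (size : Fin h → ℕ) → Rel (Σ (Fin h) (Fin ∘ size)) 0ℓ
BlowUp H size (i , _) (j , _) = Adj H i j

------------------------------------------------------------------------
-- Exhaustive enumeration

vectors : ∀ {A : Set} → List A → ∀ n → List (Vec A n)
vectors xs zero    = [] ∷ []
vectors xs (suc n) = cartesianProductWith _∷_ xs (vectors xs n)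

∈-vectors : ∀ {A : Set} {xs : List A} → (∀ x → x List.∈ xs) →
            ∀ {n} (v : Vec A n) → v List.∈ vectors xs n
∈-vectors all∈ []      = Any.here refl
∈-vectors all∈ (x ∷ v) =
  List.∈-cartesianProductWith⁺ _∷_ (all∈ x) (∈-vectors all∈ v)

simple? : ∀ {n} (M : Matrix n) → Dec (Simple M)
simple? M =
  (all? λ u → all? λ v → (v ∈? lookup M u) →-dec (u ∈? lookup M v))
  ×-dec (all? λ v → ¬? (v ∈? lookup M v))

graphs : ∀ n → List (Graph n)
graphs n =
  mapMaybe (λ M → Maybe.map (graph M) (dec⇒maybe (simple? M)))
           (vectors (vectors (true ∷ false ∷ []) n) n)

module _ {f n} (F : Graph f) (G : Graph n) where

  embedding? : (φ : Fin f → Fin n) → Dec (IsEmbedding (Adj F) (Adj G) φ)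
  embedding? φ =
    map′ (λ inj {x} {y} → inj x y) (λ inj x y → inj)
         (all? λ x → all? λ y → (φ x ≟ φ y) →-dec (x ≟ y))
    ×-dec
    map′ (λ pres {x} {y} → pres x y) (λ pres x y → pres)
         (all? λ x → all? λ y → adj? F x y →-dec adj? G (φ x) (φ y))

  embeddings : List (Vec (Fin n) f)
  embeddings = filter (embedding? ∘ lookup) (vectors (allFin n) f)

  contains? : Dec (Contains (Adj G) (Adj F))
  contains? = map′ to from (Any.any? (embedding? ∘ lookup) (vectors (allFin n) f))
    where
    to : Any.Any (IsEmbedding (Adj F) (Adj G) ∘ lookup) (vectors (allFin n) f) →
         Contains (Adj G) (Adj F)
    to p with Any.satisfied p
    ... | v , emb = lookup v , emb

    from : Contains (Adj G) (Adj F) →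
           Any.Any (IsEmbedding (Adj F) (Adj G) ∘ lookup) (vectors (allFin n) f)
    from (φ , inj , pres) =
      List.lose (∈-vectors List.∈-allFin (tabulate φ))
        ( (λ {x} {y} eq →
             inj (trans (sym (lookup∘tabulate φ x)) (trans eq (lookup∘tabulate φ y))))
        , (λ {x} {y} a →
             subst₂ (Adj G) (sym (lookup∘tabulate φ x)) (sym (lookup∘tabulate φ y)) (pres a)))

free? : ∀ {f n} (F : Graph f) (G : Graph n) → Dec (Free F G)
free? F G = ¬? (contains? F G)

------------------------------------------------------------------------
-- Copies

-- A vertex set together with an edge set, as a (symmetric) matrix.
Subgraph : ℕ → Set
Subgraph n = Subset n × Matrix n

_≟ˢ_ : ∀ {n} → DecidableEquality (Subgraph n)
_≟ˢ_ = Product.≡-dec (Vec.≡-dec Bool._≟_) (Vec.≡-dec (Vec.≡-dec Bool._≟_))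

⟦_⟧ : ∀ {n} {P : Pred (Fin n) 0ℓ} → Decidable P → Subset n
⟦ P? ⟧ = tabulate (does ∘ P?)

image : ∀ {h n} → Graph h → (Fin h → Fin n) → Subgraph n
image H φ =
    ⟦ (λ w → any? λ i → φ i ≟ w) ⟧
  , tabulate λ u → ⟦ (λ v → any? λ i → any? λ j →
                        adj? H i j ×-dec (φ i ≟ u) ×-dec (φ j ≟ v)) ⟧

-- The subgraphs of G isomorphic to H are the images of the embeddings of H
-- in G; embeddings that differ by an automorphism of H give the same copy,
-- which is counted once.
𝓝 : ∀ {h n} → Graph h → Graph n → ℕ
𝓝 H G = length (deduplicate _≟ˢ_ (map (image H ∘ lookup) (embeddings H G)))

------------------------------------------------------------------------
-- The extremal number

-- The maximum of the empty set is taken to be 0.  This only matters when F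
-- has no edge, as otherwise the edgeless graph is regular and F-free.
rex : ∀ {h f} → ℕ → Graph h → Graph f → ℕ
rex n H F = max 0 (map (𝓝 H) (filter (free? F) (filter regular? (graphs n))))

------------------------------------------------------------------------
-- Asymptotics

-- For functions with values in ℕ, a real constant can be rounded up to a
-- natural one.
_=O_ : (ℕ → ℕ) → (ℕ → ℕ) → Set
f =O g = ∃[ C ] ∃[ n₀ ] ∀ n → n₀ ≤ n → f n ≤ C * g n

_=Θ_ : (ℕ → ℕ) → (ℕ → ℕ) → Set
f =Θ g = f =O g × g =O f

module Submission where

-- F lies in a blow-up of H exactly if there is a homomorphism F → H.
--
-- If there is one, then by Erdős' theorem on h-partite h-uniform hypergraphs a
-- graph with at least c n^h copies of H contains a large balanced blow-up of H,
-- hence F, once n is large.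
--
-- If there is none and H has an edge, then H sits in a regular graph R that is
-- homomorphic to H, and the balanced blow-up of R is regular, F-free, and has
-- Θ(n^h) copies of H.  Every n is reached by adding a sparse blow-up of an odd cycle longer than F
-- (which fixes the parity) and a regular bipartite graph, both of the same
-- degree as the blow-up of R.  F misses a class of the long odd cycle, so its
-- intersection with these two parts is bipartite and maps to an edge of H.

open import Defs
open import Data.Bool.Base using (Bool; true; false; not; _∧_; _∨_; _xor_; T)
open import Data.Bool.ListAction using (all)
open import Data.Bool.Properties
  using (∧-assoc; ∧-identityʳ; ∨-comm; xor-comm; not-involutive; T-≡; T?)
open import Data.Fin.Base as Fin
  using (Fin; zero; suc; toℕ; fromℕ; inject₁; inject≤; funToFin; finToFun)
open import Data.Fin.Properties
  using (_≟_; any?; toℕ-inject₁; toℕ-fromℕ; toℕ-injective; toℕ<n; inject₁-injective;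
         inject≤-injective; combine-injective; injective⇒≤; <⇒notInjective; ¬∀⟶∃¬;
         funToFin-finToFin)
open import Data.Fin.Subset using (∣_∣)
open import Data.List.Base
  using (List; []; _∷_; _++_; map; length; lookup; take; filter; filterᵇ; deduplicate; allFin;
         cartesianProduct; cartesianProductWith)
open import Data.List.Extrema.Nat using (max≤v⁺; v≤max⁺; argmax-sel)
import Data.List.Membership.Propositional as List
import Data.List.Membership.Propositional.Properties as List
open import Data.List.Membership.Setoid.Properties using (index-injective)
open import Data.List.Properties
  using (map-cong; map-∘; map-++; map-tabulate; tabulate-lookup; length-++; length-map;
         length-take; length-tabulate; length-filter)
open import Data.List.Relation.Binary.Sublist.Propositional using (_⊆_; []; _∷_; _∷ʳ_; minimum)
open import Data.List.Relation.Binary.Sublist.Propositional.Properties using (All-resp-⊆)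
open import Data.List.Relation.Unary.All as All using (All; []; _∷_)
import Data.List.Relation.Unary.All.Properties as All
open import Data.List.Relation.Unary.AllPairs using ([]; _∷_)
open import Data.List.Relation.Unary.Any as Any using (here; there; index)
import Data.List.Relation.Unary.Any.Properties as Any
open import Data.List.Relation.Unary.Unique.Propositional using (Unique)
import Data.List.Relation.Unary.Unique.Propositional.Properties as Unique
import Data.Maybe.Base as Maybe
import Data.Maybe.Relation.Unary.Any as Maybe using (Any; just)
open import Data.Nat.Base
open import Data.Nat.DivMod
open import Data.Nat.ListAction using (sum)
open import Data.Nat.ListAction.Properties using (sum-++)
open import Data.Nat.Properties hiding (_≟_)
open import Data.Nat.Tactic.RingSolver using (solve-∀)
open import Data.Product.Base using (∃; ∃₂; ∃-syntax; _×_; _,_; proj₁; proj₂)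
open import Data.Sum.Base using (_⊎_; inj₁; inj₂)
open import Data.Vec.Base as Vec using (Vec; []; _∷_; tabulate)
open import Data.Vec.Properties using (lookup∘tabulate; []=⇒lookup; lookup⇒[]=)
open import Function.Base
open import Function.Bundles using (Equivalence; _⇔_; mk⇔)
open import Function.Definitions using (Injective)
open import Level using (0ℓ)
open import Relation.Binary.Core using (_Preserves_⟶_)
open import Relation.Binary.Definitions using (DecidableEquality)
open import Relation.Binary.PropositionalEquality
open import Relation.Nullary.Decidable.Core using (Dec; does; yes; no; dec⇒maybe; ¬?)
open import Relation.Nullary.Decidable using (dec-true; dec-false)
open import Relation.Nullary.Negation.Core using (contradiction; ¬_)
open import Relation.Unary using (Pred; Decidable)

-- The obstacle is regularity at every order `n`. If `H` is bipartite, every graph that maps to `H`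
-- is bipartite, and a regular bipartite graph of positive degree has an even number of vertices. So
-- for odd `n` no regular graph with an edge that maps to `H` exists, and some component must escape
-- `H` without admitting `F`; a long odd cycle does, since any map from `F` sees only a path in it.
-- The components that fill up `n` contribute no copies of `H` to the count; they only have to match
-- the degree and to have order linear in the class size of the blow-up of `R`, so that this class
-- size stays proportional to `n`. Throughout, `F`-freeness of the construction is proved in the
-- stronger form that not even a homomorphism from `F` exists. For the converse, the relation fed to
-- Erdős' theorem consists of ordered tuples, namely the embeddings of `H`, so that no partition of
-- the vertices has to be chosen beforehand.

private variable
  A B C : Set
  f h n m : ℕ

-- Sums over lists

∑ : List A → (A → ℕ) → ℕ
∑ xs f = sum (map f xs)

𝟙 : Bool → ℕ
𝟙 false = 0
𝟙 true  = 1

𝟙≤1 : ∀ b → 𝟙 b ≤ 1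
𝟙≤1 false = z≤n
𝟙≤1 true  = ≤-refl

𝟙-∧ : ∀ a b → 𝟙 (a ∧ b) ≡ 𝟙 a * 𝟙 b
𝟙-∧ false b = refl
𝟙-∧ true  b = sym (+-identityʳ _)

𝟙-not : ∀ a → 𝟙 a + 𝟙 (not a) ≡ 1
𝟙-not false = refl
𝟙-not true  = refl

∑-cong : ∀ {f g : A → ℕ} xs → (∀ x → f x ≡ g x) → ∑ xs f ≡ ∑ xs g
∑-cong xs f≗g = cong sum (map-cong f≗g xs)

∑-mono : ∀ {f g : A → ℕ} xs → (∀ x → f x ≤ g x) → ∑ xs f ≤ ∑ xs g
∑-mono []       f≤g = z≤n
∑-mono (x ∷ xs) f≤g = +-mono-≤ (f≤g x) (∑-mono xs f≤g)

∑-++ : ∀ (f : A → ℕ) xs ys → ∑ (xs ++ ys) f ≡ ∑ xs f + ∑ ys f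
∑-++ f xs ys = trans (cong sum (map-++ f xs ys)) (sum-++ (map f xs) (map f ys))

∑-map : ∀ (f : B → ℕ) (g : A → B) xs → ∑ (map g xs) f ≡ ∑ xs (f ∘ g)
∑-map f g xs = cong sum (sym (map-∘ xs))

∑-const : ∀ (xs : List A) c → ∑ xs (λ _ → c) ≡ length xs * c
∑-const []       c = refl
∑-const (x ∷ xs) c = cong (c +_) (∑-const xs c)

∑-zero : ∀ (xs : List A) → ∑ xs (λ _ → 0) ≡ 0
∑-zero xs = trans (∑-const xs 0) (*-zeroʳ (length xs))

∑-+ : ∀ (f g : A → ℕ) xs → ∑ xs (λ x → f x + g x) ≡ ∑ xs f + ∑ xs g
∑-+ f g []       = refl
∑-+ f g (x ∷ xs) rewrite ∑-+ f g xs = interchange (f x) (g x) (∑ xs f) (∑ xs g)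
  where
  interchange : ∀ a b c d → a + b + (c + d) ≡ a + c + (b + d)
  interchange = solve-∀

∑-*ˡ : ∀ c (f : A → ℕ) xs → ∑ xs (λ x → c * f x) ≡ c * ∑ xs f
∑-*ˡ c f []       = sym (*-zeroʳ c)
∑-*ˡ c f (x ∷ xs) rewrite ∑-*ˡ c f xs = sym (*-distribˡ-+ c (f x) (∑ xs f))

∑-*ʳ : ∀ c (f : A → ℕ) xs → ∑ xs (λ x → f x * c) ≡ ∑ xs f * c
∑-*ʳ c f xs = trans (∑-cong xs λ x → *-comm (f x) c) (trans (∑-*ˡ c f xs) (*-comm c _))

∑-comm : ∀ (f : A → B → ℕ) xs ys →
         ∑ xs (λ x → ∑ ys (f x)) ≡ ∑ ys (λ y → ∑ xs (λ x → f x y))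
∑-comm f []       ys = sym (∑-zero ys)
∑-comm f (x ∷ xs) ys =
  trans (cong (∑ ys (f x) +_) (∑-comm f xs ys)) (sym (∑-+ (f x) _ ys))

∑-cartesianProductWith : ∀ (f : C → ℕ) (g : A → B → C) xs ys →
  ∑ (cartesianProductWith g xs ys) f ≡ ∑ xs (λ x → ∑ ys (λ y → f (g x y)))
∑-cartesianProductWith f g []       ys = refl
∑-cartesianProductWith f g (x ∷ xs) ys =
  trans (∑-++ f (map (g x) ys) _)
        (cong₂ _+_ (∑-map f (g x) ys) (∑-cartesianProductWith f g xs ys))

∑-filter : ∀ {P : Pred A 0ℓ} (P? : Decidable P) (f : A → ℕ) xs →
           ∑ (filter P? xs) f ≡ ∑ xs (λ x → 𝟙 (does (P? x)) * f x)
∑-filter P? f []       = refl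
∑-filter P? f (x ∷ xs) with does (P? x)
... | true  = cong₂ _+_ (sym (+-identityʳ (f x))) (∑-filter P? f xs)
... | false = ∑-filter P? f xs

length-filter-∑ : ∀ {P : Pred A 0ℓ} (P? : Decidable P) xs →
                  length (filter P? xs) ≡ ∑ xs (λ x → 𝟙 (does (P? x)))
length-filter-∑ P? []       = refl
length-filter-∑ P? (x ∷ xs) with does (P? x)
... | true  = cong suc (length-filter-∑ P? xs)
... | false = length-filter-∑ P? xs

∑-lookup : ∀ (f : A → ℕ) xs → ∑ (allFin (length xs)) (f ∘ lookup xs) ≡ ∑ xs f
∑-lookup f xs = cong sum (trans (map-tabulate id (f ∘ lookup xs))
  (trans (sym (map-tabulate (lookup xs) f)) (cong (map f) (tabulate-lookup xs))))

∑-allFin-suc : ∀ {n} (f : Fin (suc n) → ℕ) →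
               ∑ (allFin (suc n)) f ≡ f zero + ∑ (allFin n) (f ∘ suc)
∑-allFin-suc f = cong (λ ns → f zero + sum ns)
  (trans (map-tabulate suc f) (sym (map-tabulate id (f ∘ suc))))

-- Terms that reach the threshold `s` cost at most `M`, the others at most `s`. This turns a large
-- sum into many large terms, once for rows and once for points in `dense-slices`.
markov : ∀ {f : A → ℕ} {M} s xs → (∀ x → f x ≤ M) →
         ∑ xs f ≤ ∑ xs (λ x → 𝟙 (s ≤ᵇ f x)) * M + length xs * s
markov {f = f} {M} s xs f≤M = begin
  ∑ xs f                                              ≤⟨ ∑-mono xs split ⟩
  ∑ xs (λ x → 𝟙 (s ≤ᵇ f x) * M + s)                   ≡⟨ ∑-+ _ _ xs ⟩
  ∑ xs (λ x → 𝟙 (s ≤ᵇ f x) * M) + ∑ xs (λ _ → s)      ≡⟨ cong₂ _+_ (∑-*ʳ M _ xs) (∑-const xs s) ⟩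
  ∑ xs (λ x → 𝟙 (s ≤ᵇ f x)) * M + length xs * s       ∎
  where
  open ≤-Reasoning
  split : ∀ x → f x ≤ 𝟙 (s ≤ᵇ f x) * M + s
  split x with s ≤ᵇ f x in eq
  ... | true  = ≤-trans (f≤M x) (≤-trans (≤-reflexive (sym (+-identityʳ M))) (m≤m+n (M + 0) s))
  ... | false = <⇒≤ (≰⇒> λ s≤fx → subst T eq (≤⇒≤ᵇ s≤fx))

-- Boxes in dense relations

count : List A → (A → Bool) → ℕ
count xs p = ∑ xs (𝟙 ∘ p)

count≤length : ∀ (xs : List A) p → count xs p ≤ length xs
count≤length xs p = ≤-trans (∑-mono xs (𝟙≤1 ∘ p))
  (≤-reflexive (trans (∑-const xs 1) (*-identityʳ _)))

count-witness : ∀ (xs : List A) p → 0 < count xs p → ∃ λ x → p x ≡ true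
count-witness (x ∷ xs) p 0<# with p x in px
... | true  = x , px
... | false = count-witness xs p 0<#

count-split : ∀ (xs : List A) (p q : A → Bool) →
  count xs p ≡ count xs (λ x → p x ∧ q x) + count xs (λ x → p x ∧ not (q x))
count-split xs p q = trans (∑-cong xs λ x → split (p x) (q x)) (∑-+ _ _ xs)
  where
  split : ∀ a b → 𝟙 a ≡ 𝟙 (a ∧ b) + 𝟙 (a ∧ not b)
  split false b = refl
  split true  b = sym (𝟙-not b)

length*≤∑ : ∀ {f : A → ℕ} {c xs} → All (λ x → c ≤ f x) xs → length xs * c ≤ ∑ xs f
length*≤∑ []           = z≤n
length*≤∑ (c≤fx ∷ all) = +-mono-≤ c≤fx (length*≤∑ all)

∧-true⁻ : ∀ a {b} → a ∧ b ≡ true → a ≡ true × b ≡ true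
∧-true⁻ true eq = refl , eq

all-lookup : ∀ (p : A → Bool) {xs x} → all p xs ≡ true → x List.∈ xs → p x ≡ true
all-lookup p {y ∷ _} eq (here refl) = proj₁ (∧-true⁻ (p y) eq)
all-lookup p {y ∷ _} eq (there x∈)  = all-lookup p (proj₂ (∧-true⁻ (p y) eq)) x∈

Unique-resp-⊆ : ∀ {xs ys : List A} → xs ⊆ ys → Unique ys → Unique xs
Unique-resp-⊆ []         []         = []
Unique-resp-⊆ (_ ∷ʳ τ)   (_ ∷ u)    = Unique-resp-⊆ τ u
Unique-resp-⊆ (refl ∷ τ) (y∉ ∷ u)   = All-resp-⊆ τ y∉ ∷ Unique-resp-⊆ τ u

lookup-injective : ∀ {xs : List A} → Unique xs → Injective _≡_ _≡_ (lookup xs)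
lookup-injective (_ ∷ _)   {zero}  {zero}  _  = refl
lookup-injective (x∉ ∷ _)  {zero}  {suc j} eq = contradiction eq (All.lookup x∉ (List.∈-lookup j))
lookup-injective (x∉ ∷ _)  {suc i} {zero}  eq = contradiction (sym eq) (All.lookup x∉ (List.∈-lookup i))
lookup-injective (_ ∷ u)   {suc i} {suc j} eq = cong suc (lookup-injective u eq)

listing : ∀ {t} (xs : List A) → Unique xs → length xs ≡ t →
          ∃ λ (α : Fin t → A) → Injective _≡_ _≡_ α × (∀ j → α j List.∈ xs)
listing xs u refl = lookup xs , lookup-injective u , List.∈-lookup

length-cartesianProductWith : ∀ (g : A → B → C) xs ys →
  length (cartesianProductWith g xs ys) ≡ length xs * length ys
length-cartesianProductWith g []       ys = refl
length-cartesianProductWith g (x ∷ xs) ys =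
  trans (length-++ (map (g x) ys))
        (cong₂ _+_ (length-map (g x) ys) (length-cartesianProductWith g xs ys))

length-vectors : ∀ (xs : List A) n → length (vectors xs n) ≡ length xs ^ n
length-vectors xs zero    = refl
length-vectors xs (suc n) = trans (length-cartesianProductWith _∷_ xs (vectors xs n))
                                  (cong (length xs *_) (length-vectors xs n))

length-allFin : ∀ n → length (allFin n) ≡ n
length-allFin n = length-tabulate {n = n} id

length-vectors-allFin : ∀ n h → length (vectors (allFin n) h) ≡ n ^ h
length-vectors-allFin n h = trans (length-vectors (allFin n) h) (cong (_^ h) (length-allFin n))

-- Split the points of Q according to the first row and keep the larger half.
common-rows : ∀ (S : A → B → Bool) (xs : List B) rows t (Q : B → Bool) →
  (∀ x → Q x ≡ true → t ≤ count rows (λ r → S r x)) → 0 < count xs Q →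
  ∃ λ zs → zs ⊆ rows × length zs ≡ t ×
    count xs Q ≤ 2 ^ length rows * count xs (λ x → Q x ∧ all (λ r → S r x) zs)
common-rows S xs rows zero Q many Q≢∅ = [] , minimum rows , refl ,
  ≤-trans (≤-reflexive (∑-cong xs λ x → cong 𝟙 (sym (∧-identityʳ (Q x)))))
          (m≤n*m _ (2 ^ length rows) {{m^n≢0 2 (length rows)}})
-- A point of `Q` would lie in `suc t` rows out of none. Nonemptiness of `Q` is carried through the
-- recursion to rule this case out.
common-rows S xs [] (suc t) Q many Q≢∅ with count-witness xs Q Q≢∅
... | x , Qx = contradiction (many x Qx) λ ()
common-rows S xs (r ∷ rows) t@(suc t′) Q many Q≢∅
  with ≤-total (count xs (λ x → Q x ∧ not (S r x))) (count xs (λ x → Q x ∧ S r x))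
... | inj₁ out≤in =
  let zs , zs⊆rows , ∣zs∣≡t′ , bound = common-rows S xs rows t′ (λ x → Q x ∧ S r x) many-in in≢∅
  in  r ∷ zs , refl ∷ zs⊆rows , cong suc ∣zs∣≡t′ , (begin
    count xs Q               ≤⟨ half ⟩
    2 * #in                  ≤⟨ *-monoʳ-≤ 2 bound ⟩
    2 * (2 ^ length rows * count xs (λ x → (Q x ∧ S r x) ∧ all (λ r → S r x) zs))
      ≡⟨ sym (*-assoc 2 (2 ^ length rows) _) ⟩
    2 ^ suc (length rows) * count xs (λ x → (Q x ∧ S r x) ∧ all (λ r → S r x) zs)
      ≡⟨ cong (2 ^ suc (length rows) *_) (∑-cong xs λ x → cong 𝟙 (∧-assoc (Q x) (S r x) _)) ⟩
    2 ^ suc (length rows) * count xs (λ x → Q x ∧ all (λ r → S r x) (r ∷ zs)) ∎)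
  where
  open ≤-Reasoning
  #in #out : ℕ
  #in  = count xs (λ x → Q x ∧ S r x)
  #out = count xs (λ x → Q x ∧ not (S r x))
  half : count xs Q ≤ 2 * #in
  half = begin
    count xs Q   ≡⟨ count-split xs Q (S r) ⟩
    #in + #out   ≤⟨ +-monoʳ-≤ #in (≤-trans out≤in (m≤m+n #in 0)) ⟩
    2 * #in      ∎
  in≢∅ : 0 < #in
  in≢∅ = *-cancelˡ-< 2 0 #in (<-≤-trans Q≢∅ half)
  -- The kept points all lie in row `r`, so they need one row less among the remaining ones, just as
  -- one row less remains to be chosen.
  many-in : ∀ x → Q x ∧ S r x ≡ true → t′ ≤ count rows (λ r → S r x)
  many-in x eq with Qx , Srx ← ∧-true⁻ (Q x) eq | many-x ← many x (proj₁ (∧-true⁻ (Q x) eq))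
    rewrite Srx = s≤s⁻¹ many-x
... | inj₂ in≤out =
  let zs , zs⊆rows , ∣zs∣≡t , bound = common-rows S xs rows t (λ x → Q x ∧ not (S r x)) many-out out≢∅
  in  zs , r ∷ʳ zs⊆rows , ∣zs∣≡t , (begin
    count xs Q               ≤⟨ half ⟩
    2 * #out                 ≤⟨ *-monoʳ-≤ 2 bound ⟩
    2 * (2 ^ length rows * count xs (λ x → (Q x ∧ not (S r x)) ∧ all (λ r → S r x) zs))
      ≡⟨ sym (*-assoc 2 (2 ^ length rows) _) ⟩
    2 ^ suc (length rows) * count xs (λ x → (Q x ∧ not (S r x)) ∧ all (λ r → S r x) zs)
      ≤⟨ *-monoʳ-≤ (2 ^ suc (length rows)) (∑-mono xs λ x → drop (Q x) (not (S r x)) _) ⟩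
    2 ^ suc (length rows) * count xs (λ x → Q x ∧ all (λ r → S r x) zs) ∎)
  where
  open ≤-Reasoning
  #in #out : ℕ
  #in  = count xs (λ x → Q x ∧ S r x)
  #out = count xs (λ x → Q x ∧ not (S r x))
  half : count xs Q ≤ 2 * #out
  half = begin
    count xs Q   ≡⟨ count-split xs Q (S r) ⟩
    #in + #out   ≤⟨ +-mono-≤ in≤out (m≤m+n #out 0) ⟩
    2 * #out     ∎
  out≢∅ : 0 < #out
  out≢∅ = *-cancelˡ-< 2 0 #out (<-≤-trans Q≢∅ half)
  many-out : ∀ x → Q x ∧ not (S r x) ≡ true → t ≤ count rows (λ r → S r x)
  many-out x eq with S r x | proj₂ (∧-true⁻ (Q x) eq) | many x (proj₁ (∧-true⁻ (Q x) eq))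
  ... | false | _ | many-x = many-x
  drop : ∀ a b c → 𝟙 ((a ∧ b) ∧ c) ≤ 𝟙 (a ∧ c)
  drop false b     c = z≤n
  drop true  false c = z≤n
  drop true  true  c = ≤-refl

-- The classes `α i` may overlap: they are told apart by the coordinate of the tuple.
Box : ∀ {n h} → (Vec (Fin n) h → Bool) → ℕ → Set
Box {n} {h} R t = ∃ λ (α : Fin h → Fin t → Fin n) →
  (∀ i → Injective _≡_ _≡_ (α i)) ×
  (∀ (js : Fin h → Fin t) → R (Vec.tabulate λ i → α i (js i)) ≡ true)

-- Many rows a have a dense slice R (a ∷ _), and a bounded number b of dense
-- slices already contains t of them whose intersection is dense.
dense-slices : ∀ t c .{{_ : NonZero t}} .{{_ : NonZero c}} {n h} (R : Vec (Fin n) (suc h) → Bool) →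
  let b = 4 * c * t in 2 * c * b < n →
  n ^ suc h ≤ c * count (vectors (allFin n) (suc h)) R →
  ∃ λ zs → Unique zs × length zs ≡ t ×
    n ^ h ≤ 4 * c * 2 ^ b * count (vectors (allFin n) h) (λ x → all (λ a → R (a ∷ x)) zs)
dense-slices t c {n} {h} R 2cb<n dense =
  let zs , zs⊆rows , ∣zs∣≡t , bound = common-rows (λ a x → R (a ∷ x)) X rows t good good⇒many good≢∅
  in  zs , Unique-resp-⊆ zs⊆rows rows-unique , ∣zs∣≡t , (begin
    N                            ≤⟨ N≤good ⟩
    4 * c * count X good         ≤⟨ *-monoʳ-≤ (4 * c) bound ⟩
    4 * c * (2 ^ length rows * count X (λ x → good x ∧ all (λ a → R (a ∷ x)) zs))
      ≡⟨ cong (λ l → 4 * c * (2 ^ l * count X (λ x → good x ∧ all (λ a → R (a ∷ x)) zs))) length-rows ⟩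
    4 * c * (2 ^ b * count X (λ x → good x ∧ all (λ a → R (a ∷ x)) zs))
      ≡⟨ sym (*-assoc (4 * c) (2 ^ b) _) ⟩
    4 * c * 2 ^ b * count X (λ x → good x ∧ all (λ a → R (a ∷ x)) zs)
      ≤⟨ *-monoʳ-≤ (4 * c * 2 ^ b) (∑-mono X λ x → drop (good x) _) ⟩
    4 * c * 2 ^ b * count X (λ x → all (λ a → R (a ∷ x)) zs) ∎)
  where
  open ≤-Reasoning
  b N : ℕ
  -- A rich row has density at least 1/(2c), so a point lies on average in at least b/(2c) = 2t of
  -- the `b` chosen rows, twice the threshold in `good`.
  b = 4 * c * t
  N = n ^ h
  X : List (Vec (Fin n) h)
  X = vectors (allFin n) h
  row : Fin n → ℕ
  row a = count X (λ x → R (a ∷ x))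
  -- The average of `row` is at least `N`/c by density; a rich row reaches half of this.
  rich : Fin n → Bool
  rich a = N ≤ᵇ 2 * c * row a
  #rich : ℕ
  #rich = count (allFin n) rich
  rows : List (Fin n)
  rows = take b (filterᵇ rich (allFin n))
  column : Vec (Fin n) h → ℕ
  column x = count rows (λ a → R (a ∷ x))
  good : Vec (Fin n) h → Bool
  good x = t ≤ᵇ column x

  instance
    n≢0 : NonZero n
    n≢0 = >-nonZero (≤-<-trans z≤n 2cb<n)
    N≢0 : NonZero N
    N≢0 = m^n≢0 n h
    4c≢0 : NonZero (4 * c)
    4c≢0 = m*n≢0 4 c
    2c≢0 : NonZero (2 * c)
    2c≢0 = m*n≢0 2 c
    2ct≢0 : NonZero (2 * c * t)
    2ct≢0 = m*n≢0 (2 * c) t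

  drop : ∀ p q → 𝟙 (p ∧ q) ≤ 𝟙 q
  drop false q = z≤n
  drop true  q = ≤-refl

  row≤N : ∀ a → row a ≤ N
  row≤N a = ≤-trans (count≤length X _) (≤-reflexive (length-vectors-allFin n h))

  n≤#rich : n ≤ 2 * c * #rich
  n≤#rich = *-cancelʳ-≤ n (2 * c * #rich) N (+-cancelʳ-≤ (n * N) _ _ (begin
    n * N + n * N                                      ≡⟨ cong (n * N +_) (sym (+-identityʳ (n * N))) ⟩
    2 * (n * N)                                        ≤⟨ *-monoʳ-≤ 2 dense ⟩
    2 * (c * count (vectors (allFin n) (suc h)) R)     ≡⟨ sym (*-assoc 2 c _) ⟩
    2 * c * count (vectors (allFin n) (suc h)) R
      ≡⟨ cong (2 * c *_) (∑-cartesianProductWith (𝟙 ∘ R) _∷_ (allFin n) X) ⟩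
    2 * c * ∑ (allFin n) row                           ≡⟨ sym (∑-*ˡ (2 * c) row (allFin n)) ⟩
    ∑ (allFin n) (λ a → 2 * c * row a)
      ≤⟨ markov N (allFin n) (λ a → *-monoʳ-≤ (2 * c) (row≤N a)) ⟩
    #rich * (2 * c * N) + length (allFin n) * N
      ≡⟨ cong₂ _+_ (rearrange #rich (2 * c) N) (cong (_* N) (length-allFin n)) ⟩
    2 * c * #rich * N + n * N                          ∎))
    where
    rearrange : ∀ x y z → x * (y * z) ≡ y * x * z
    rearrange = solve-∀

  -- The lower bound on `n` is there to provide `b` rich rows.
  b≤#rich : b ≤ #rich
  b≤#rich = <⇒≤ (*-cancelˡ-< (2 * c) b #rich (<-≤-trans 2cb<n n≤#rich))

  length-rows : length rows ≡ b
  length-rows = trans (length-take b (filterᵇ rich (allFin n)))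
    (m≤n⇒m⊓n≡m (subst (b ≤_) (sym (length-filter-∑ (T? ∘ rich) (allFin n))) b≤#rich))

  rows-unique : Unique rows
  rows-unique = Unique.take⁺ b (Unique.filter⁺ (T? ∘ rich) (Unique.allFin⁺ n))

  rows-rich : All (λ a → N ≤ 2 * c * row a) rows
  rows-rich = All.map (≤ᵇ⇒≤ N _) (All.take⁺ b (All.all-filter (T? ∘ rich) (allFin n)))

  N≤good : N ≤ 4 * c * count X good
  N≤good = *-cancelˡ-≤ (2 * c * t) (+-cancelʳ-≤ (2 * c * t * N) _ _ (begin
    2 * c * t * N + 2 * c * t * N          ≡⟨ double c t N ⟩
    b * N                                  ≡⟨ cong (_* N) (sym length-rows) ⟩
    length rows * N                        ≤⟨ length*≤∑ rows-rich ⟩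
    ∑ rows (λ a → 2 * c * row a)           ≡⟨ ∑-*ˡ (2 * c) row rows ⟩
    2 * c * ∑ rows row                     ≡⟨ cong (2 * c *_) (∑-comm (λ a x → 𝟙 (R (a ∷ x))) rows X) ⟩
    2 * c * ∑ X column                     ≤⟨ *-monoʳ-≤ (2 * c) (markov t X (λ x → count≤length rows _)) ⟩
    2 * c * (count X good * length rows + length X * t)
      ≡⟨ cong (2 * c *_) (cong₂ _+_ (cong (count X good *_) length-rows)
                                    (cong (_* t) (length-vectors-allFin n h))) ⟩
    2 * c * (count X good * b + N * t)     ≡⟨ expand c t N (count X good) ⟩
    2 * c * t * (4 * c * count X good) + 2 * c * t * N ∎))
    where
    double : ∀ c t N → 2 * c * t * N + 2 * c * t * N ≡ 4 * c * t * N
    double = solve-∀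
    expand : ∀ c t N G → 2 * c * (G * (4 * c * t) + N * t) ≡ 2 * c * t * (4 * c * G) + 2 * c * t * N
    expand = solve-∀

  good≢∅ : 0 < count X good
  good≢∅ = *-cancelˡ-< (4 * c) 0 (count X good)
    (<-≤-trans (≤-<-trans (≤-reflexive (*-zeroʳ (4 * c))) (>-nonZero⁻¹ N)) N≤good)

  good⇒many : ∀ x → good x ≡ true → t ≤ column x
  good⇒many x eq = ≤ᵇ⇒≤ t _ (Equivalence.from T-≡ eq)

-- Erdős' theorem on complete h-partite h-uniform hypergraphs.
dense⇒Box : ∀ t c .{{_ : NonZero t}} .{{_ : NonZero c}} h →
  ∃[ n₀ ] ∀ n → n₀ ≤ n → (R : Vec (Fin n) h → Bool) →
  n ^ h ≤ c * count (vectors (allFin n) h) R → Box R t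
dense⇒Box t c zero = 0 , λ n _ R dense → (λ ()) , (λ ()) , λ _ → R[]≡true R dense
  where
  R[]≡true : ∀ {n} (R : Vec (Fin n) 0 → Bool) → 1 ≤ c * (𝟙 (R []) + 0) → R [] ≡ true
  R[]≡true R 1≤ with R []
  ... | true  = refl
  ... | false = contradiction (subst (1 ≤_) (*-zeroʳ c) 1≤) λ ()
dense⇒Box t c (suc h) = proj₁ IH ⊔ suc (2 * c * (4 * c * t)) , box
  where
  instance
    c′≢0 : NonZero (4 * c * 2 ^ (4 * c * t))
    c′≢0 = m*n≢0 (4 * c) (2 ^ (4 * c * t)) {{m*n≢0 4 c}} {{m^n≢0 2 (4 * c * t)}}
  IH : ∃[ n₀ ] ∀ n → n₀ ≤ n → (R : Vec (Fin n) h → Bool) →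
       n ^ h ≤ 4 * c * 2 ^ (4 * c * t) * count (vectors (allFin n) h) R → Box R t
  IH = dense⇒Box t (4 * c * 2 ^ (4 * c * t)) h
  box : ∀ n → proj₁ IH ⊔ suc (2 * c * (4 * c * t)) ≤ n → (R : Vec (Fin n) (suc h) → Bool) →
        n ^ suc h ≤ c * count (vectors (allFin n) (suc h)) R → Box R t
  box n n₀≤n R dense =
    let zs , zs-unique , ∣zs∣≡t , common-dense =
          dense-slices t c R (≤-trans (m≤n⊔m (proj₁ IH) _) n₀≤n) dense
        β , β-injective , β∈zs = listing zs zs-unique ∣zs∣≡t
        α , α-injective , α-box =
          proj₂ IH n (≤-trans (m≤m⊔n (proj₁ IH) _) n₀≤n) _ common-dense
    in  (λ { zero → β ; (suc i) → α i })
      , (λ { zero → β-injective ; (suc i) → α-injective i })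
      , λ js → all-lookup (λ a → R (a ∷ Vec.tabulate λ i → α i (js (suc i))))
                          (α-box (js ∘ suc)) (β∈zs (js zero))

-- Copies and the extremal number

does-true : ∀ {P : Set} (P? : Dec P) → does P? ≡ true → P
does-true (yes p) _ = p

length-deduplicate : ∀ (_≈?_ : DecidableEquality A) xs → length (deduplicate _≈?_ xs) ≤ length xs
length-deduplicate _≈?_ []       = z≤n
length-deduplicate _≈?_ (x ∷ xs) =
  s≤s (≤-trans (length-filter (¬? ∘ (x ≈?_)) (deduplicate _≈?_ xs)) (length-deduplicate _≈?_ xs))

embeddingᵇ : Graph h → Graph n → Vec (Fin n) h → Bool
embeddingᵇ H G v = does (embedding? H G (Vec.lookup v))

𝓝≤count : ∀ (H : Graph h) (G : Graph n) → 𝓝 H G ≤ count (vectors (allFin n) h) (embeddingᵇ H G)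
𝓝≤count {h} {n} H G = begin
  𝓝 H G                                      ≤⟨ length-deduplicate _≟ˢ_ (map (image H ∘ Vec.lookup) (embeddings H G)) ⟩
  length (map (image H ∘ Vec.lookup) (embeddings H G)) ≡⟨ length-map (image H ∘ Vec.lookup) (embeddings H G) ⟩
  length (embeddings H G)                    ≡⟨ length-filter-∑ (embedding? H G ∘ Vec.lookup) (vectors (allFin n) h) ⟩
  count (vectors (allFin n) h) (embeddingᵇ H G) ∎
  where open ≤-Reasoning

𝓝≤n^h : ∀ (H : Graph h) (G : Graph n) → 𝓝 H G ≤ n ^ h
𝓝≤n^h {h} {n} H G = begin
  𝓝 H G                                         ≤⟨ 𝓝≤count H G ⟩
  count (vectors (allFin n) h) (embeddingᵇ H G) ≤⟨ count≤length (vectors (allFin n) h) (embeddingᵇ H G) ⟩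
  length (vectors (allFin n) h)                 ≡⟨ length-vectors-allFin n h ⟩
  n ^ h                                         ∎
  where open ≤-Reasoning

rex≤n^h : ∀ n (H : Graph h) (F : Graph f) → rex n H F ≤ n ^ h
rex≤n^h n H F = max≤v⁺ z≤n (All.map⁺ (All.universal (𝓝≤n^h H)
  (filter (free? F) (filter regular? (graphs n)))))

-- The proof of simplicity stored in the listed graph may differ from the one
-- in G, but no other notion depends on that proof.
graphs-complete : ∀ (G : Graph n) → ∃ λ p → graph (neighbours G) p List.∈ graphs n
graphs-complete {n} G with simple? (neighbours G) in eq
... | no ¬p = contradiction (simple G) ¬p
... | yes p = p , Any.mapMaybe⁺ _ (vectors (vectors (true ∷ false ∷ []) n) n)
  (Any.map⁺ (List.lose (∈-vectors (∈-vectors ∈-bools) (neighbours G)) listed))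
  where
  ∈-bools : ∀ b → b List.∈ (true ∷ false ∷ [])
  ∈-bools true  = here refl
  ∈-bools false = there (here refl)
  listed : Maybe.Any (graph (neighbours G) p ≡_)
             (Maybe.map (graph (neighbours G)) (dec⇒maybe (simple? (neighbours G))))
  listed rewrite eq = Maybe.just refl

𝓝≤rex : ∀ (H : Graph h) (F : Graph f) (G : Graph n) → Regular G → Free F G → 𝓝 H G ≤ rex n H F
𝓝≤rex {n = n} H F G regular free =
  let p , G∈ = graphs-complete G
  in v≤max⁺ 0 (map (𝓝 H) (filter (free? F) (filter regular? (graphs n))))
    (inj₂ (List.lose (List.∈-map⁺ (𝓝 H)
      (List.∈-filter⁺ (free? F) {graph (neighbours G) p} (List.∈-filter⁺ regular? G∈ regular) free)) ≤-refl))

-- A nonzero value cannot be the default of `max`, so an actual graph attains it. Its regularity is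
-- dropped: the argument against density applies to all `F`-free graphs.
rex-attained : ∀ (H : Graph h) (F : Graph f) → rex n H F ≢ 0 →
               ∃ λ (G : Graph n) → Free F G × rex n H F ≡ 𝓝 H G
rex-attained {n = n} H F rex≢0
  with argmax-sel id 0 (map (𝓝 H) (filter (free? F) (filter regular? (graphs n))))
... | inj₁ rex≡0 = contradiction rex≡0 rex≢0
... | inj₂ rex∈ =
  let G , G∈ , rex≡ = List.∈-map⁻ (𝓝 H) rex∈
  in  G , proj₂ (List.∈-filter⁻ (free? F) {xs = filter regular? (graphs n)} G∈) , rex≡

module _ (H : Graph h) (G : Graph n) (ι : Contains (Adj G) (BlowUp H (λ _ → m))) where

  private
    ψ : Fin h × Fin m → Fin n
    ψ = proj₁ ι

    copy : (Fin h → Fin m) → Vec (Fin n) h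
    copy x = tabulate λ i → ψ (i , x i)

    lookup-copy : ∀ x i → Vec.lookup (copy x) i ≡ ψ (i , x i)
    lookup-copy x = lookup∘tabulate λ i → ψ (i , x i)

    copy-embedding : ∀ x → IsEmbedding (Adj H) (Adj G) (Vec.lookup (copy x))
    copy-embedding x
      = (λ {i} {j} eq → cong proj₁ (proj₁ (proj₂ ι)
          (trans (sym (lookup-copy x i)) (trans eq (lookup-copy x j)))))
      , (λ {i} {j} ij → subst₂ (Adj G) (sym (lookup-copy x i)) (sym (lookup-copy x j))
          (proj₂ (proj₂ ι) ij))

    copies : List (Subgraph n)
    copies = deduplicate _≟ˢ_ (map (image H ∘ Vec.lookup) (embeddings H G))

    copy∈ : ∀ x → image H (Vec.lookup (copy x)) List.∈ copies
    copy∈ x = List.∈-deduplicate⁺ _≟ˢ_ (List.∈-map⁺ (image H ∘ Vec.lookup)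
      (List.∈-filter⁺ (embedding? H G ∘ Vec.lookup) (∈-vectors List.∈-allFin (copy x)) (copy-embedding x)))

    -- The copy meets the i-th class in the single vertex ψ (i , x i).
    image-injective : ∀ x y → image H (Vec.lookup (copy x)) ≡ image H (Vec.lookup (copy y)) → x ≗ y
    image-injective x y eq i =
      let w = ψ (i , x i)
          vertex? = λ z → any? λ j → Vec.lookup (copy z) j ≟ w
          in-y : does (vertex? y) ≡ true
          in-y = trans (sym (lookup∘tabulate _ w))
                 (trans (cong (λ S → Vec.lookup (proj₁ S) w) (sym eq))
                 (trans (lookup∘tabulate _ w) (dec-true (vertex? x) (i , lookup-copy x i))))
          j , yj≡w = does-true (vertex? y) in-y
      in  same (proj₁ (proj₂ ι) (trans (sym (lookup-copy y j)) yj≡w))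
      where
      same : ∀ {j} → (j , y j) ≡ (i , x i) → x i ≡ y i
      same eq′ with refl ← cong proj₁ eq′ = sym (cong proj₂ eq′)

  -- Choosing one vertex in each class gives a copy, and the vertex set of the copy already
  -- determines the choice, so nothing is lost when embeddings that differ by an automorphism are
  -- identified. The positions in the list of copies then give an injection from the `m ^ h`
  -- choices.
  blowUp-copies : m ^ h ≤ 𝓝 H G
  blowUp-copies = injective⇒≤ {f = λ k → index (copy∈ (finToFun k))} λ {k} {l} eq →
    trans (sym (funToFin-finToFin {h} {m} k))
    (trans (funToFin-cong (image-injective (finToFun k) (finToFun l)
             (index-injective (setoid _) (copy∈ (finToFun k)) (copy∈ (finToFun l)) eq)))
           (funToFin-finToFin {h} {m} l))
    where
    funToFin-cong : ∀ {a b} {u v : Fin a → Fin b} → u ≗ v → funToFin u ≡ funToFin v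
    funToFin-cong {zero}  u≗v = refl
    funToFin-cong {suc a} u≗v = cong₂ Fin.combine (u≗v zero) (funToFin-cong (u≗v ∘ suc))

-- Homomorphisms into H, and the upper bound when there is one

Hom : Graph f → Graph h → Set
Hom F H = ∃ λ θ → θ Preserves Adj F ⟶ Adj H

contains⇒hom : ∀ {F : Graph f} {H : Graph h} → ∃[ size ] Contains (BlowUp H size) (Adj F) → Hom F H
contains⇒hom (_ , φ , _ , pres) = proj₁ ∘ φ , pres

-- Parts of size `f` leave room for each vertex to carry itself as a label, which makes the map
-- injective whatever the fibres of `θ` are.
hom⇒contains : ∀ {F : Graph f} {H : Graph h} → Hom F H → ∃[ size ] Contains (BlowUp H size) (Adj F)
hom⇒contains {f} (θ , pres) = (λ _ → f) , (λ x → θ x , x) , cong proj₂ , pres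

Box⇒contains : ∀ (F : Graph f) (H : Graph h) (G : Graph n) → Hom F H →
               Box (embeddingᵇ H G) (suc f) → Contains (Adj G) (Adj F)
Box⇒contains {f} {h} {n} F H G (θ , θ-pres) (α , α-injective , box) = φ , φ-injective , φ-pres
  where
  φ : Fin f → Fin n
  φ x = α (θ x) (inject₁ x)

  -- Two places of different classes lie on a common transversal of the box, which is an embedding
  -- of `H`. Its injectivity separates the possibly overlapping classes, and its preservation of
  -- edges gives the edges between them.
  through : ∀ x y → θ x ≢ θ y → ∃ λ ψ → IsEmbedding (Adj H) (Adj G) ψ × ψ (θ x) ≡ φ x × ψ (θ y) ≡ φ y
  through x y θx≢θy = Vec.lookup (tabulate λ i → α i (js i))
    , does-true (embedding? H G _) (box js)
    , trans (lookup∘tabulate _ (θ x)) (cong (α (θ x)) js-x)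
    , trans (lookup∘tabulate _ (θ y)) (cong (α (θ y)) js-y)
    where
    js : Fin h → Fin (suc f)
    js i with i ≟ θ x
    ... | yes _ = inject₁ x
    ... | no  _ = inject₁ y
    js-x : js (θ x) ≡ inject₁ x
    js-x with θ x ≟ θ x
    ... | yes _ = refl
    ... | no ≢  = contradiction refl ≢
    js-y : js (θ y) ≡ inject₁ y
    js-y with θ y ≟ θ x
    ... | yes ≡ = contradiction (sym ≡) θx≢θy
    ... | no  _ = refl

  φ-injective : Injective _≡_ _≡_ φ
  φ-injective {x} {y} φx≡φy with θ x ≟ θ y
  ... | yes θx≡θy = inject₁-injective (α-injective (θ x)
    (trans φx≡φy (cong (λ i → α i (inject₁ y)) (sym θx≡θy))))
  ... | no θx≢θy =
    let ψ , (ψ-injective , _) , ψx , ψy = through x y θx≢θy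
    in  contradiction (ψ-injective (trans ψx (trans φx≡φy (sym ψy)))) θx≢θy

  φ-pres : φ Preserves Adj F ⟶ Adj G
  φ-pres {x} {y} xy =
    let ψ , (_ , ψ-pres) , ψx , ψy = through x y λ θx≡θy →
          proj₂ (simple H) (θ y) (subst (λ i → Adj H i (θ y)) θx≡θy (θ-pres xy))
    in  subst₂ (Adj G) ψx ψy (ψ-pres (θ-pres xy))

hom⇒¬dense : ∀ (F : Graph f) (H : Graph h) → Hom F H → ¬ ((λ n → n ^ h) =O (λ n → rex n H F))
hom⇒¬dense {f} {h} F H hom (C , n₀ , many) =
  let G , free , rex≡𝓝 = rex-attained {n = N} H F rex≢0
  in  free (Box⇒contains F H G hom (proj₂ boxes N (≤-trans (m≤n⊔m n₀ n₁) (n≤1+n _)) (embeddingᵇ H G) (begin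
    N ^ h                                                     ≤⟨ n^h≤ ⟩
    C * rex N H F                                             ≡⟨ cong (C *_) rex≡𝓝 ⟩
    C * 𝓝 H G                                                 ≤⟨ *-mono-≤ (n≤1+n C) (𝓝≤count H G) ⟩
    suc C * count (vectors (allFin N) h) (embeddingᵇ H G)     ∎)))
  where
  open ≤-Reasoning
  -- The successors only make the class size and the constant positive.
  boxes = dense⇒Box (suc f) (suc C) h
  n₁ N : ℕ
  n₁ = proj₁ boxes
  -- Positive, so that `N ^ h` and with it `rex N H F` is nonzero, and `rex-attained` applies.
  N = suc (n₀ ⊔ n₁)
  n^h≤ : N ^ h ≤ C * rex N H F
  n^h≤ = many N (≤-trans (m≤m⊔n n₀ n₁) (n≤1+n _))
  rex≢0 : rex N H F ≢ 0
  rex≢0 rex≡0 = <⇒≱ (m^n>0 N h)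
    (≤-trans n^h≤ (≤-reflexive (trans (cong (C *_) rex≡0) (*-zeroʳ C))))

-- Regular graphs

∑-allFin-last : ∀ {n} (f : Fin (suc n) → ℕ) →
                ∑ (allFin (suc n)) f ≡ ∑ (allFin n) (f ∘ inject₁) + f (fromℕ n)
∑-allFin-last {zero}  f = +-identityʳ (f zero)
∑-allFin-last {suc n} f = begin
  ∑ (allFin (2 + n)) f                                            ≡⟨ ∑-allFin-suc f ⟩
  f zero + ∑ (allFin (suc n)) (f ∘ suc)                           ≡⟨ cong (f zero +_) (∑-allFin-last (f ∘ suc)) ⟩
  f zero + (∑ (allFin n) (f ∘ suc ∘ inject₁) + f (fromℕ (suc n))) ≡⟨ sym (+-assoc (f zero) _ _) ⟩
  f zero + ∑ (allFin n) (f ∘ suc ∘ inject₁) + f (fromℕ (suc n))   ≡⟨ cong (_+ f (fromℕ (suc n))) (sym (∑-allFin-suc (f ∘ inject₁))) ⟩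
  ∑ (allFin (suc n)) (f ∘ inject₁) + f (fromℕ (suc n))            ∎
  where open ≡-Reasoning

does-≟-comm : ∀ (i j : Fin n) → does (i ≟ j) ≡ does (j ≟ i)
does-≟-comm zero    zero    = refl
does-≟-comm zero    (suc j) = refl
does-≟-comm (suc i) zero    = refl
does-≟-comm (suc i) (suc j) = does-≟-comm i j

∑-δ : ∀ (i : Fin n) (g : Fin n → ℕ) → ∑ (allFin n) (λ j → 𝟙 (does (i ≟ j)) * g j) ≡ g i
∑-δ {suc n} zero    g = trans (∑-allFin-suc λ j → 𝟙 (does (zero ≟ j)) * g j)
  (trans (cong₂ _+_ (+-identityʳ (g zero)) (∑-zero (allFin n))) (+-identityʳ (g zero)))
∑-δ {suc n} (suc i) g = trans (∑-allFin-suc λ j → 𝟙 (does (suc i ≟ j)) * g j) (∑-δ i (g ∘ suc))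

∑-δ-1 : ∀ (i : Fin n) → ∑ (allFin n) (λ j → 𝟙 (does (i ≟ j))) ≡ 1
∑-δ-1 {n} i = trans (∑-cong (allFin n) λ j → sym (*-identityʳ _)) (∑-δ i (λ _ → 1))

∣tabulate∣ : ∀ (p : Fin n → Bool) → ∣ tabulate p ∣ ≡ ∑ (allFin n) (𝟙 ∘ p)
∣tabulate∣ {zero}  p = refl
∣tabulate∣ {suc n} p rewrite ∑-allFin-suc (𝟙 ∘ p) with p zero
... | true  = cong suc (∣tabulate∣ (p ∘ suc))
... | false = ∣tabulate∣ (p ∘ suc)

-- The vertices are the entries of a list, counted with multiplicity.
record ListGraph : Set₁ where
  field
    {V}      : Set
    vertices : List V
    _~_      : V → V → Bool
    ~-sym    : ∀ u v → u ~ v ≡ v ~ u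
    ~-irrefl : ∀ v → v ~ v ≡ false

  deg : V → ℕ
  deg v = ∑ vertices (λ w → 𝟙 (v ~ w))

  _~ᵗ_ : V → V → Set
  u ~ᵗ v = u ~ v ≡ true

open ListGraph

toGraph : (G : ListGraph) → Graph (length (vertices G))
toGraph G = graph M (symmetric , irreflexive)
  where
  edge : Fin (length (vertices G)) → Fin (length (vertices G)) → Bool
  edge i j = _~_ G (lookup (vertices G) i) (lookup (vertices G) j)
  M : Matrix (length (vertices G))
  M = tabulate λ i → tabulate (edge i)
  entry : ∀ i j → Vec.lookup (Vec.lookup M i) j ≡ edge i j
  entry i j = trans (cong (λ r → Vec.lookup r j) (lookup∘tabulate (λ i → tabulate (edge i)) i))
                    (lookup∘tabulate (edge i) j)
  symmetric : ∀ i j → _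
  symmetric i j ij = lookup⇒[]= i _
    (trans (entry j i) (trans (~-sym G _ _) (trans (sym (entry i j)) ([]=⇒lookup ij))))
  irreflexive : ∀ i → _
  irreflexive i ii with () ← trans (sym ([]=⇒lookup ii)) (trans (entry i i) (~-irrefl G _))

module _ (G : ListGraph) where
  private
    v[_] : Fin (length (vertices G)) → V G
    v[ i ] = lookup (vertices G) i

    row : ∀ i → Vec.lookup (neighbours (toGraph G)) i ≡ tabulate (λ j → _~_ G v[ i ] v[ j ])
    row i = lookup∘tabulate (λ i → tabulate (λ j → _~_ G v[ i ] v[ j ])) i

  toGraph-~ : ∀ {i j} → Adj (toGraph G) i j → _~ᵗ_ G v[ i ] v[ j ]
  toGraph-~ {i} {j} ij = trans (sym (lookup∘tabulate (λ j → _~_ G v[ i ] v[ j ]) j))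
    (trans (cong (λ r → Vec.lookup r j) (sym (row i))) ([]=⇒lookup ij))

  ~-toGraph : ∀ {i j} → _~ᵗ_ G v[ i ] v[ j ] → Adj (toGraph G) i j
  ~-toGraph {i} {j} ij = lookup⇒[]= j _
    (trans (cong (λ r → Vec.lookup r j) (row i)) (trans (lookup∘tabulate _ j) ij))

  degree-toGraph : ∀ i → degree (toGraph G) i ≡ deg G v[ i ]
  degree-toGraph i = trans (cong ∣_∣ (row i)) (trans (∣tabulate∣ (λ j → _~_ G v[ i ] v[ j ]))
    (∑-lookup (λ w → 𝟙 (_~_ G v[ i ] w)) (vertices G)))

  -- The absence of a homomorphism is demanded, not merely of an embedding: a vertex may be listed
  -- repeatedly, so an embedding into `toGraph G` need not stay injective when list positions are
  -- read as vertices.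
  blowUp⇒rex : ∀ (F : Graph f) (H : Graph h) {d} → (∀ v → deg G v ≡ d) →
    ¬ (∃ λ g → g Preserves Adj F ⟶ _~ᵗ_ G) →
    (ι : Fin h × Fin m → V G) → Injective _≡_ _≡_ ι → (∀ x → ι x List.∈ vertices G) →
    (∀ i x j y → Adj H i j → _~ᵗ_ G (ι (i , x)) (ι (j , y))) →
    m ^ h ≤ rex (length (vertices G)) H F
  blowUp⇒rex F H regular no-hom ι ι-injective ι∈ ι-pres =
    ≤-trans (blowUp-copies H (toGraph G) (φ , φ-injective , φ-pres))
      (𝓝≤rex H F (toGraph G)
        (λ u v → trans (degree-toGraph u) (trans (regular _) (sym (trans (degree-toGraph v) (regular _)))))
        (λ (ψ , _ , ψ-pres) → no-hom (v[_] ∘ ψ , toGraph-~ ∘ ψ-pres)))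
    where
    φ : _ → Fin (length (vertices G))
    φ x = index (ι∈ x)
    φ-vertex : ∀ x → v[ φ x ] ≡ ι x
    φ-vertex x = sym (Any.lookup-index (ι∈ x))
    φ-injective : Injective _≡_ _≡_ φ
    φ-injective {x} {y} eq = ι-injective (trans (sym (φ-vertex x)) (trans (cong v[_] eq) (φ-vertex y)))
    φ-pres : φ Preserves BlowUp H _ ⟶ Adj (toGraph G)
    φ-pres {i , x} {j , y} ij = ~-toGraph
      (subst₂ (_~ᵗ_ G) (sym (φ-vertex _)) (sym (φ-vertex _)) (ι-pres i x j y ij))

-- Disjoint sums, sparse blow-ups and regularisation

infixr 5 _⊕_
_⊕_ : ListGraph → ListGraph → ListGraph
G ⊕ G′ = record
  { vertices = map inj₁ (vertices G) ++ map inj₂ (vertices G′)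
  ; _~_      = edge
  ; ~-sym    = λ { (inj₁ u) (inj₁ v) → ~-sym G u v ; (inj₁ u) (inj₂ v) → refl
                 ; (inj₂ u) (inj₁ v) → refl        ; (inj₂ u) (inj₂ v) → ~-sym G′ u v }
  ; ~-irrefl = λ { (inj₁ v) → ~-irrefl G v ; (inj₂ v) → ~-irrefl G′ v }
  }
  where
  edge : V G ⊎ V G′ → V G ⊎ V G′ → Bool
  edge (inj₁ u) (inj₁ v) = _~_ G u v
  edge (inj₂ u) (inj₂ v) = _~_ G′ u v
  edge _        _        = false

∑-⊎ : ∀ (f : A ⊎ B → ℕ) xs ys →
      ∑ (map inj₁ xs ++ map inj₂ ys) f ≡ ∑ xs (f ∘ inj₁) + ∑ ys (f ∘ inj₂)
∑-⊎ f xs ys = trans (∑-++ f (map inj₁ xs) _) (cong₂ _+_ (∑-map f inj₁ xs) (∑-map f inj₂ ys))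

deg-⊕ : ∀ G G′ {d} → (∀ v → deg G v ≡ d) → (∀ v → deg G′ v ≡ d) → ∀ v → deg (G ⊕ G′) v ≡ d
deg-⊕ G G′ reg reg′ (inj₁ v) = trans (∑-⊎ _ (vertices G) (vertices G′))
  (trans (cong₂ _+_ (reg v) (∑-zero (vertices G′))) (+-identityʳ _))
deg-⊕ G G′ reg reg′ (inj₂ v) = trans (∑-⊎ _ (vertices G) (vertices G′))
  (cong₂ _+_ (∑-zero (vertices G)) (reg′ v))

-- Every edge of G becomes a t-regular bipartite graph between two classes of
-- size s.
_⊗[_,_] : ListGraph → (s t : ℕ) .{{_ : NonZero s}} → ListGraph
G ⊗[ s , t ] = record
  { vertices = cartesianProduct (vertices G) (allFin s)
  -- A condition on the sum of the indices, unlike one on their difference, is symmetric. For `t`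
  -- equal to `s` it is vacuous and the result is the balanced blow-up.
  ; _~_      = λ (u , x) (v , y) → _~_ G u v ∧ ((toℕ x + toℕ y) % s <ᵇ t)
  ; ~-sym    = λ (u , x) (v , y) → cong₂ _∧_ (~-sym G u v) (cong (λ z → z % s <ᵇ t) (+-comm (toℕ x) (toℕ y)))
  ; ~-irrefl = λ (v , x) → cong (_∧ ((toℕ x + toℕ x) % s <ᵇ t)) (~-irrefl G v)
  }

-- Both sides add up `ψ` over 0, ..., `s`.
∑-shift : ∀ (ψ : ℕ → ℕ) s →
          ψ 0 + ∑ (allFin s) (ψ ∘ suc ∘ toℕ) ≡ ψ s + ∑ (allFin s) (ψ ∘ toℕ)
∑-shift ψ zero    = refl
∑-shift ψ (suc s) = begin
  ψ 0 + ∑ (allFin (suc s)) (ψ ∘ suc ∘ toℕ)              ≡⟨ cong (ψ 0 +_) (∑-allFin-suc {s} (ψ ∘ suc ∘ toℕ)) ⟩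
  ψ 0 + (ψ 1 + ∑ (allFin s) (λ y → ψ (2 + toℕ y)))        ≡⟨ cong (ψ 0 +_) (∑-shift (ψ ∘ suc) s) ⟩
  ψ 0 + (ψ (suc s) + ∑ (allFin s) (ψ ∘ suc ∘ toℕ))      ≡⟨ swap (ψ 0) (ψ (suc s)) _ ⟩
  ψ (suc s) + (ψ 0 + ∑ (allFin s) (ψ ∘ suc ∘ toℕ))      ≡⟨ cong (ψ (suc s) +_) (sym (∑-allFin-suc {s} (ψ ∘ toℕ))) ⟩
  ψ (suc s) + ∑ (allFin (suc s)) (ψ ∘ toℕ)              ∎
  where
  open ≡-Reasoning
  swap : ∀ a b c → a + (b + c) ≡ b + (a + c)
  swap = solve-∀

∑-periodic : ∀ (ψ : ℕ → ℕ) s → (∀ z → ψ (z + s) ≡ ψ z) → ∀ a →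
             ∑ (allFin s) (λ y → ψ (a + toℕ y)) ≡ ∑ (allFin s) (ψ ∘ toℕ)
∑-periodic ψ s periodic zero    = refl
∑-periodic ψ s periodic (suc a) = trans
  (∑-periodic (ψ ∘ suc) s (periodic ∘ suc) a)
  (+-cancelˡ-≡ (ψ 0) _ _ (trans (∑-shift ψ s) (cong (_+ ∑ (allFin s) (ψ ∘ toℕ)) (periodic 0))))

∑-initial : ∀ s t → t ≤ s → ∑ (allFin s) (λ y → 𝟙 (toℕ y <ᵇ t)) ≡ t
∑-initial s       zero    _   = ∑-zero (allFin s)
∑-initial (suc s) (suc t) t≤s =
  trans (∑-allFin-suc {s} (λ y → 𝟙 (toℕ y <ᵇ suc t))) (cong suc (∑-initial s t (s≤s⁻¹ t≤s)))

-- The numbers `a + toℕ y` form a window of length `s`, which meets every residue once; by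
-- periodicity it can be slid back to start at 0.
∑-circulant : ∀ s t .{{_ : NonZero s}} → t ≤ s → ∀ a →
              ∑ (allFin s) (λ y → 𝟙 ((a + toℕ y) % s <ᵇ t)) ≡ t
∑-circulant s t t≤s a = begin
  ∑ (allFin s) (λ y → 𝟙 ((a + toℕ y) % s <ᵇ t))
    ≡⟨ ∑-periodic (λ z → 𝟙 (z % s <ᵇ t)) s (λ z → cong (λ r → 𝟙 (r <ᵇ t)) ([m+n]%n≡m%n z s)) a ⟩
  ∑ (allFin s) (λ y → 𝟙 (toℕ y % s <ᵇ t))
    ≡⟨ ∑-cong (allFin s) (λ y → cong (λ r → 𝟙 (r <ᵇ t)) (m<n⇒m%n≡m (toℕ<n y))) ⟩
  ∑ (allFin s) (λ y → 𝟙 (toℕ y <ᵇ t))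
    ≡⟨ ∑-initial s t t≤s ⟩
  t ∎
  where open ≡-Reasoning

deg-⊗ : ∀ G s t .{{_ : NonZero s}} → t ≤ s → ∀ {d} → (∀ v → deg G v ≡ d) →
        ∀ v → deg (G ⊗[ s , t ]) v ≡ d * t
deg-⊗ G s t t≤s {d} regular (u , x) = begin
  deg (G ⊗[ s , t ]) (u , x)
    ≡⟨ ∑-cartesianProductWith _ _,_ (vertices G) (allFin s) ⟩
  ∑ (vertices G) (λ v → ∑ (allFin s) (λ y → 𝟙 (_~_ G u v ∧ circ y)))
    ≡⟨ ∑-cong (vertices G) (λ v → begin
       ∑ (allFin s) (λ y → 𝟙 (_~_ G u v ∧ circ y))      ≡⟨ ∑-cong (allFin s) (λ y → 𝟙-∧ (_~_ G u v) (circ y)) ⟩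
       ∑ (allFin s) (λ y → 𝟙 (_~_ G u v) * 𝟙 (circ y))  ≡⟨ ∑-*ˡ (𝟙 (_~_ G u v)) _ (allFin s) ⟩
       𝟙 (_~_ G u v) * ∑ (allFin s) (𝟙 ∘ circ)          ≡⟨ cong (𝟙 (_~_ G u v) *_) (∑-circulant s t t≤s (toℕ x)) ⟩
       𝟙 (_~_ G u v) * t                                ∎) ⟩
  ∑ (vertices G) (λ v → 𝟙 (_~_ G u v) * t)
    ≡⟨ ∑-*ʳ t _ (vertices G) ⟩
  deg G u * t
    ≡⟨ cong (_* t) (regular u) ⟩
  d * t ∎
  where
  open ≡-Reasoning
  circ : Fin s → Bool
  circ y = (toℕ x + toℕ y) % s <ᵇ t

-- Regularisation of H: h copies of H, and for each non-adjacent pair (v , w),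
-- a new vertex joined to the h copies of v; it is represented by v.
module _ (H : Graph h) where

  edgeᵇ : Fin h → Fin h → Bool
  edgeᵇ u v = does (adj? H u v)

  edgeᵇ-sym : ∀ u v → edgeᵇ u v ≡ edgeᵇ v u
  edgeᵇ-sym u v with adj? H v u
  ... | yes vu = dec-true (adj? H u v) (proj₁ (simple H) v u vu)
  ... | no ¬vu = dec-false (adj? H u v) (¬vu ∘ proj₁ (simple H) u v)

  regularisation : ListGraph
  regularisation = record
    { vertices = map inj₁ (cartesianProduct (allFin h) (allFin h))
              ++ map inj₂ (map proj₁ (filter (λ (u , v) → ¬? (adj? H u v))
                                             (cartesianProduct (allFin h) (allFin h))))
    ; _~_      = edge
    ; ~-sym    = λ { (inj₁ (u , i)) (inj₁ (v , j)) → cong₂ _∧_ (edgeᵇ-sym u v) (does-≟-comm i j)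
                   ; (inj₁ _) (inj₂ _) → refl ; (inj₂ _) (inj₁ _) → refl ; (inj₂ _) (inj₂ _) → refl }
    ; ~-irrefl = λ { (inj₁ (v , i)) → cong (_∧ does (i ≟ i)) (dec-false (adj? H v v) (proj₂ (simple H) v))
                   ; (inj₂ _) → refl }
    }
    where
    edge : Fin h × Fin h ⊎ Fin h → Fin h × Fin h ⊎ Fin h → Bool
    edge (inj₁ (u , i)) (inj₁ (v , j)) = edgeᵇ u v ∧ does (i ≟ j)
    edge (inj₁ (u , _)) (inj₂ w)       = does (u ≟ w)
    edge (inj₂ w)       (inj₁ (u , _)) = does (u ≟ w)
    edge (inj₂ _)       (inj₂ _)       = false

  -- A vertex of a copy keeps its neighbours in `H` and gains one new neighbour for each
  -- non-neighbour, itself included: `h` in all. A new vertex has one neighbour in each copy, which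
  -- is why there are `h` copies.
  deg-regularisation : ∀ v → deg regularisation v ≡ h
  deg-regularisation (inj₁ (u , i)) = begin
    deg regularisation (inj₁ (u , i))
      ≡⟨ ∑-⊎ _ pairs (map proj₁ (filter nonadj? pairs)) ⟩
    ∑ pairs (λ (v , j) → 𝟙 (edgeᵇ u v ∧ does (i ≟ j))) + ∑ (map proj₁ (filter nonadj? pairs)) (λ w → 𝟙 (does (u ≟ w)))
      ≡⟨ cong₂ _+_ in-copy outside ⟩
    ∑ (allFin h) (λ v → 𝟙 (edgeᵇ u v)) + ∑ (allFin h) (λ v → 𝟙 (not (edgeᵇ u v)))
      ≡⟨ sym (∑-+ _ _ (allFin h)) ⟩
    ∑ (allFin h) (λ v → 𝟙 (edgeᵇ u v) + 𝟙 (not (edgeᵇ u v)))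
      ≡⟨ ∑-cong (allFin h) (λ v → 𝟙-not (edgeᵇ u v)) ⟩
    ∑ (allFin h) (λ _ → 1)
      ≡⟨ trans (∑-const (allFin h) 1) (trans (*-identityʳ _) (length-allFin h)) ⟩
    h ∎
    where
    open ≡-Reasoning
    pairs : List (Fin h × Fin h)
    pairs = cartesianProduct (allFin h) (allFin h)
    nonadj? : ∀ ((u , v) : Fin h × Fin h) → Dec (¬ Adj H u v)
    nonadj? (u , v) = ¬? (adj? H u v)
    in-copy : ∑ pairs (λ (v , j) → 𝟙 (edgeᵇ u v ∧ does (i ≟ j))) ≡ ∑ (allFin h) (λ v → 𝟙 (edgeᵇ u v))
    in-copy = trans (∑-cartesianProductWith _ _,_ (allFin h) (allFin h)) (∑-cong (allFin h) λ v → begin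
      ∑ (allFin h) (λ j → 𝟙 (edgeᵇ u v ∧ does (i ≟ j)))       ≡⟨ ∑-cong (allFin h) (λ j → 𝟙-∧ (edgeᵇ u v) _) ⟩
      ∑ (allFin h) (λ j → 𝟙 (edgeᵇ u v) * 𝟙 (does (i ≟ j)))   ≡⟨ ∑-*ˡ (𝟙 (edgeᵇ u v)) _ (allFin h) ⟩
      𝟙 (edgeᵇ u v) * ∑ (allFin h) (λ j → 𝟙 (does (i ≟ j)))   ≡⟨ cong (𝟙 (edgeᵇ u v) *_) (∑-δ-1 i) ⟩
      𝟙 (edgeᵇ u v) * 1                                       ≡⟨ *-identityʳ _ ⟩
      𝟙 (edgeᵇ u v)                                           ∎)
    outside : ∑ (map proj₁ (filter nonadj? pairs)) (λ w → 𝟙 (does (u ≟ w))) ≡ ∑ (allFin h) (λ v → 𝟙 (not (edgeᵇ u v)))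
    outside = begin
      ∑ (map proj₁ (filter nonadj? pairs)) (λ w → 𝟙 (does (u ≟ w)))
        ≡⟨ ∑-map _ proj₁ (filter nonadj? pairs) ⟩
      ∑ (filter nonadj? pairs) (λ (w , _) → 𝟙 (does (u ≟ w)))
        ≡⟨ ∑-filter nonadj? _ pairs ⟩
      ∑ pairs (λ (w , v) → 𝟙 (not (edgeᵇ w v)) * 𝟙 (does (u ≟ w)))
        ≡⟨ ∑-cartesianProductWith _ _,_ (allFin h) (allFin h) ⟩
      ∑ (allFin h) (λ w → ∑ (allFin h) (λ v → 𝟙 (not (edgeᵇ w v)) * 𝟙 (does (u ≟ w))))
        ≡⟨ ∑-cong (allFin h) (λ w → trans (∑-*ʳ (𝟙 (does (u ≟ w))) _ (allFin h)) (*-comm _ (𝟙 (does (u ≟ w))))) ⟩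
      ∑ (allFin h) (λ w → 𝟙 (does (u ≟ w)) * ∑ (allFin h) (λ v → 𝟙 (not (edgeᵇ w v))))
        ≡⟨ ∑-δ u _ ⟩
      ∑ (allFin h) (λ v → 𝟙 (not (edgeᵇ u v))) ∎
  deg-regularisation (inj₂ w) = begin
    deg regularisation (inj₂ w)
      ≡⟨ ∑-⊎ _ (cartesianProduct (allFin h) (allFin h)) ws ⟩
    ∑ (cartesianProduct (allFin h) (allFin h)) (λ (u , _) → 𝟙 (does (u ≟ w))) + ∑ ws (λ _ → 0)
      ≡⟨ cong₂ _+_ (∑-cartesianProductWith _ _,_ (allFin h) (allFin h)) (∑-zero ws) ⟩
    ∑ (allFin h) (λ u → ∑ (allFin h) (λ _ → 𝟙 (does (u ≟ w)))) + 0
      ≡⟨ +-identityʳ _ ⟩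
    ∑ (allFin h) (λ u → ∑ (allFin h) (λ _ → 𝟙 (does (u ≟ w))))
      ≡⟨ ∑-cong (allFin h) (λ u → trans (∑-const (allFin h) _) (trans (*-comm (length (allFin h)) _)
           (cong₂ _*_ (cong 𝟙 (does-≟-comm u w)) (length-allFin h)))) ⟩
    ∑ (allFin h) (λ u → 𝟙 (does (w ≟ u)) * h)
      ≡⟨ ∑-δ w (λ _ → h) ⟩
    h ∎
    where
    open ≡-Reasoning
    ws : List (Fin h)
    ws = map proj₁ (filter (λ (u , v) → ¬? (adj? H u v)) (cartesianProduct (allFin h) (allFin h)))

-- The filling components: an edge and an odd cycle

K₂ : ListGraph
K₂ = record
  { vertices = false ∷ true ∷ []
  ; _~_      = _xor_
  ; ~-sym    = xor-comm
  ; ~-irrefl = λ { false → refl ; true → refl }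
  }

deg-K₂ : ∀ v → deg K₂ v ≡ 1
deg-K₂ false = refl
deg-K₂ true  = refl

cyclicPred : Fin (suc n) → Fin (suc n)
cyclicPred {n} zero    = fromℕ n
cyclicPred     (suc i) = inject₁ i

∑-cyclicPred : ∀ (g : Fin (suc n) → ℕ) → ∑ (allFin (suc n)) (g ∘ cyclicPred) ≡ ∑ (allFin (suc n)) g
∑-cyclicPred {n} g = trans (∑-allFin-suc (g ∘ cyclicPred))
  (trans (+-comm (g (fromℕ n)) _) (sym (∑-allFin-last g)))

cyclicPred≢ : ∀ (i : Fin (2 + n)) → cyclicPred i ≢ i
cyclicPred≢ zero    ()
cyclicPred≢ (suc i) eq = 1+n≢n (sym (trans (sym (toℕ-inject₁ i)) (cong toℕ eq)))

-- This is where length at least 3 enters: predecessor and successor are distinct, so that the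
-- degree is 2.
cyclicPred²≢ : ∀ (i : Fin (3 + n)) → cyclicPred (cyclicPred i) ≢ i
cyclicPred²≢ zero          ()
cyclicPred²≢ (suc zero)    ()
cyclicPred²≢ (suc (suc i)) eq = m≢1+n+m (toℕ i) {1} (trans (sym (trans (toℕ-inject₁ _) (toℕ-inject₁ i))) (cong toℕ eq))

cycle : ℕ → ListGraph
cycle r = record
  { vertices = allFin (3 + r)
  ; _~_      = λ i j → does (cyclicPred i ≟ j) ∨ does (cyclicPred j ≟ i)
  ; ~-sym    = λ i j → ∨-comm (does (cyclicPred i ≟ j)) _
  ; ~-irrefl = λ i → cong₂ _∨_ (loopless i) (loopless i)
  }
  where
  loopless : ∀ i → does (cyclicPred i ≟ i) ≡ false
  loopless i = dec-false (cyclicPred i ≟ i) (cyclicPred≢ i)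

deg-cycle : ∀ r v → deg (cycle r) v ≡ 2
deg-cycle r i = begin
  deg (cycle r) i
    ≡⟨ ∑-cong (allFin (3 + r)) disjoint ⟩
  ∑ (allFin (3 + r)) (λ j → 𝟙 (does (cyclicPred i ≟ j)) + 𝟙 (does (i ≟ cyclicPred j)))
    ≡⟨ ∑-+ (λ j → 𝟙 (does (cyclicPred i ≟ j))) (λ j → 𝟙 (does (i ≟ cyclicPred j))) (allFin (3 + r)) ⟩
  ∑ (allFin (3 + r)) (λ j → 𝟙 (does (cyclicPred i ≟ j))) + ∑ (allFin (3 + r)) (λ j → 𝟙 (does (i ≟ cyclicPred j)))
    ≡⟨ cong₂ _+_ (∑-δ-1 (cyclicPred i)) (trans (∑-cyclicPred λ j → 𝟙 (does (i ≟ j))) (∑-δ-1 i)) ⟩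
  2 ∎
  where
  open ≡-Reasoning
  disjoint : ∀ j → 𝟙 (does (cyclicPred i ≟ j) ∨ does (cyclicPred j ≟ i))
                 ≡ 𝟙 (does (cyclicPred i ≟ j)) + 𝟙 (does (i ≟ cyclicPred j))
  disjoint j rewrite does-≟-comm i (cyclicPred j) with cyclicPred i ≟ j
  ... | no _     = refl
  ... | yes refl = cong (suc ∘ 𝟙) (sym (dec-false (cyclicPred (cyclicPred i) ≟ i) (cyclicPred²≢ i)))

odd : ℕ → Bool
odd zero    = false
odd (suc n) = not (odd n)

odd[n+n] : ∀ n → odd (n + n) ≡ false
odd[n+n] zero    = refl
odd[n+n] (suc n) rewrite +-suc n n | odd[n+n] n = refl

-- An odd cycle becomes a path, hence bipartite, when the vertex c is removed:
-- the parity of the position is flipped behind c.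
colour : Fin n → Fin n → Bool
colour c i = odd (toℕ i) xor does (toℕ c <? toℕ i)

-- The closing edge joins the even positions 0 and `2 + r`, of which only the second is behind `c`,
-- so the flip separates them. Along any other edge the parity changes and the flip does not,
-- because `c` is not the lower end.
colour-cyclicPred : ∀ {r} → odd r ≡ false → ∀ (c i : Fin (3 + r)) → c ≢ i → c ≢ cyclicPred i →
                    colour c i ≡ not (colour c (cyclicPred i))
colour-cyclicPred {r} even c zero c≢i c≢i⁻ rewrite toℕ-fromℕ r | even =
  cong not (sym (dec-true (toℕ c <? 2 + r) (≤∧≢⇒< (s≤s⁻¹ (toℕ<n c))
    λ eq → c≢i⁻ (toℕ-injective (trans eq (cong (2 +_) (sym (toℕ-fromℕ r))))))))
colour-cyclicPred even c (suc i) c≢i c≢i⁻ rewrite toℕ-inject₁ i = flip-odd (odd (toℕ i)) before-or-after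
  where
  flip-odd : ∀ a {b b′} → b ≡ b′ → (not a) xor b ≡ not (a xor b′)
  flip-odd false refl = refl
  flip-odd true {false} refl = refl
  flip-odd true {true}  refl = refl
  before-or-after : does (toℕ c <? suc (toℕ i)) ≡ does (toℕ c <? toℕ i)
  before-or-after with toℕ c <? toℕ i
  ... | yes c<i = trans (dec-true (toℕ c <? suc (toℕ i)) (<-trans c<i (n<1+n _)))
                        (sym (dec-true (toℕ c <? toℕ i) c<i))
  ... | no  c≮i = trans
    (dec-false (toℕ c <? suc (toℕ i)) λ c<1+i →
      c≮i (≤∧≢⇒< (s≤s⁻¹ c<1+i) λ eq → c≢i⁻ (toℕ-injective (trans eq (sym (toℕ-inject₁ i))))))
    (sym (dec-false (toℕ c <? toℕ i) c≮i))

∨-true⁻ : ∀ a {b} → a ∨ b ≡ true → a ≡ true ⊎ b ≡ true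
∨-true⁻ true  eq = inj₁ refl
∨-true⁻ false eq = inj₂ eq

colour-proper : ∀ {r} → odd r ≡ false → ∀ (c i j : Fin (3 + r)) → c ≢ i → c ≢ j →
                _~ᵗ_ (cycle r) i j → colour c i ≡ not (colour c j)
colour-proper even c i j c≢i c≢j ij with ∨-true⁻ (does (cyclicPred i ≟ j)) ij
... | inj₁ eq with refl ← does-true (cyclicPred i ≟ j) eq = colour-cyclicPred even c i c≢i c≢j
... | inj₂ eq with refl ← does-true (cyclicPred j ≟ i) eq =
  trans (sym (not-involutive _)) (cong not (sym (colour-cyclicPred even c j c≢j c≢i)))

-- The extremal graph

missed-value : m < n → (κ : Fin m → Fin n) → ∃ λ c → ∀ x → c ≢ κ x
missed-value {m} {n} m<n κ =
  let c , unattained = ¬∀⟶∃¬ n (λ c → ∃ λ x → κ x ≡ c) (λ c → any? λ x → κ x ≟ c)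
        λ attained → <⇒notInjective {f = proj₁ ∘ attained} m<n λ {c} {d} eq →
          trans (sym (proj₂ (attained c))) (trans (cong κ eq) (proj₂ (attained d)))
  in  c , λ x eq → unattained (x , sym eq)

-- The extremal graph has n = 2 (∣R∣ q + (2f + 3) h q + (f + 1) r + 2 h q + k) + r
-- vertices.  Its first component contains the copies of H; the odd cycle has
-- length 2f + 3, and r ∈ {0, 1} adjusts the parity and k the residue of n.
module Construction (H : Graph h) (f : ℕ) {a b : Fin h} (ab : Adj H a b) .{{_ : NonZero h}}
                    (q r k : ℕ) .{{_ : NonZero q}} where

  private
    D : ℕ
    -- The classes of the blow-up of `R` have even size `2 * q` so that the degree is even, as the
    -- blow-up of a cycle requires.
    D = h * (2 * q)
    instance
      2q≢0 : NonZero (2 * q)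
      2q≢0 = m*n≢0 2 q
      D≢0 : NonZero D
      D≢0 = m*n≢0 h (2 * q)
      D+r≢0 : NonZero (D + r)
      D+r≢0 = >-nonZero (≤-trans (>-nonZero⁻¹ D) (m≤m+n D r))
      D+k≢0 : NonZero (D + k)
      D+k≢0 = >-nonZero (≤-trans (>-nonZero⁻¹ D) (m≤m+n D k))

  R R* C* K* G : ListGraph
  R  = regularisation H
  R* = R ⊗[ 2 * q , 2 * q ]
  -- The second parameter alone fixes the degree, so the class size is free to absorb `r` here and
  -- `k` in `K*`. This is the reason for sparse blow-ups.
  C* = cycle (f + f) ⊗[ D + r , h * q ]
  K* = K₂ ⊗[ D + k , D ]
  G  = R* ⊕ C* ⊕ K*

  deg-G : ∀ v → deg G v ≡ D
  deg-G = deg-⊕ R* (C* ⊕ K*) (deg-⊗ R _ _ ≤-refl (deg-regularisation H))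
         (deg-⊕ C* K*
           (λ v → trans (deg-⊗ (cycle (f + f)) (D + r) (h * q) hq≤ (deg-cycle (f + f)) v) (double h q))
           (λ v → trans (deg-⊗ K₂ (D + k) D (m≤m+n D k) deg-K₂ v) (*-identityˡ D)))
    where
    double : ∀ h q → 2 * (h * q) ≡ h * (2 * q)
    double = solve-∀
    hq≤ : h * q ≤ D + r
    hq≤ = ≤-trans (*-monoʳ-≤ h (m≤m+n q (q + 0))) (m≤m+n D r)

  length-G : length (vertices G) ≡
    2 * ((length (vertices R) + (2 * f + 5) * h) * q + suc f * r + k) + r
  length-G = begin
    length (vertices G)
      ≡⟨ trans (length-++ (map inj₁ xs)) (cong₂ _+_ (length-map inj₁ xs) (length-map inj₂ (map inj₁ ys ++ map inj₂ zs))) ⟩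
    length xs + length (map inj₁ ys ++ map inj₂ zs)
      ≡⟨ cong (length xs +_) (trans (length-++ (map inj₁ ys)) (cong₂ _+_ (length-map inj₁ ys) (length-map inj₂ zs))) ⟩
    length xs + (length ys + length zs)
      ≡⟨ cong₂ _+_ (length-cp (vertices R) (2 * q)) (cong₂ _+_
           (trans (length-cp (allFin (3 + (f + f))) (D + r)) (cong (_* (D + r)) (length-allFin (3 + (f + f)))))
           (length-cp (false ∷ true ∷ []) (D + k))) ⟩
    length (vertices R) * (2 * q) + ((3 + (f + f)) * (D + r) + 2 * (D + k))
      ≡⟨ arith (length (vertices R)) f h q r k ⟩
    2 * ((length (vertices R) + (2 * f + 5) * h) * q + suc f * r + k) + r ∎
    where
    open ≡-Reasoning
    xs = cartesianProduct (vertices R) (allFin (2 * q))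
    ys = cartesianProduct (allFin (3 + (f + f))) (allFin (D + r))
    zs = cartesianProduct (false ∷ true ∷ []) (allFin (D + k))
    length-cp : ∀ {A : Set} (us : List A) s → length (cartesianProduct us (allFin s)) ≡ length us * s
    length-cp us s = trans (length-cartesianProductWith _,_ us (allFin s)) (cong (length us *_) (length-allFin s))
    arith : ∀ w f h q r k → w * (2 * q) + ((3 + (f + f)) * (h * (2 * q) + r) + 2 * (h * (2 * q) + k)) ≡
            2 * ((w + (2 * f + 5) * h) * q + (1 + f) * r + k) + r
    arith = solve-∀

  -- An edge of H, which starts at v unless v is isolated.
  edge-at : ∀ v → ∃₂ λ x y → Adj H x y × (∀ {u} → Adj H v u → x ≡ v)
  edge-at v with any? (adj? H v)
  ... | yes (u , vu) = v , u , vu , λ _ → refl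
  ... | no isolated  = a , b , ab , λ vu → contradiction (_ , vu) isolated

  edge-at-pres : ∀ {u v} → Adj H u v → Adj H (proj₁ (edge-at u)) (proj₁ (edge-at v))
  edge-at-pres {u} {v} uv = subst₂ (Adj H)
    (sym (proj₂ (proj₂ (proj₂ (edge-at u))) uv))
    (sym (proj₂ (proj₂ (proj₂ (edge-at v))) (proj₁ (simple H) u v uv))) uv

  -- A new vertex sees only the copies of one vertex `w`, so any neighbour of the image of `w` can
  -- serve as its image. An isolated `w` has no neighbour, hence its copies are moved to the end `a`
  -- of the given edge.
  R→H : V R → Fin h
  R→H (inj₁ (v , _)) = proj₁ (edge-at v)
  R→H (inj₂ w)       = proj₁ (proj₂ (edge-at w))

  R→H-pres : R→H Preserves _~ᵗ_ R ⟶ Adj H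
  R→H-pres {inj₁ (u , i)} {inj₁ (v , j)} uv =
    edge-at-pres (does-true (adj? H u v) (proj₁ (∧-true⁻ (edgeᵇ H u v) uv)))
  R→H-pres {inj₁ (u , i)} {inj₂ w} uw with refl ← does-true (u ≟ w) uw =
    proj₁ (proj₂ (proj₂ (edge-at u)))
  R→H-pres {inj₂ w} {inj₁ (u , i)} uw with refl ← does-true (u ≟ w) uw =
    proj₁ (simple H) _ _ (proj₁ (proj₂ (proj₂ (edge-at u))))

  side : Bool → Fin h
  side false = a
  side true  = b

  side-pres : ∀ p p′ → p ≡ not p′ → Adj H (side p) (side p′)
  side-pres _ false refl = proj₁ (simple H) _ _ ab
  side-pres _ true  refl = ab

  -- Total, so that `missed-value` applies to all vertices of `F` at once. Off the odd cycle the
  -- value is an arbitrary default, which at most makes `c` avoid one more position.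
  position : V G → Fin (3 + (f + f))
  position (inj₂ (inj₁ (i , _))) = i
  position _                     = zero

  G→H : Fin (3 + (f + f)) → V G → Fin h
  G→H c (inj₁ (v , _))        = R→H v
  G→H c (inj₂ (inj₁ (i , _))) = side (colour c i)
  G→H c (inj₂ (inj₂ (p , _))) = side p

  G→H-pres : ∀ c u v → c ≢ position u → c ≢ position v → _~ᵗ_ G u v → Adj H (G→H c u) (G→H c v)
  G→H-pres c (inj₁ (u , _)) (inj₁ (v , _)) _ _ uv = R→H-pres {u} {v} (proj₁ (∧-true⁻ (_~_ R u v) uv))
  G→H-pres c (inj₂ (inj₁ (i , _))) (inj₂ (inj₁ (j , _))) c≢i c≢j ij =
    side-pres _ _ (colour-proper (odd[n+n] f) c i j c≢i c≢j (proj₁ (∧-true⁻ (_~_ (cycle (f + f)) i j) ij)))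
  G→H-pres c (inj₂ (inj₂ (p , _))) (inj₂ (inj₂ (p′ , _))) _ _ pp′ =
    side-pres p p′ (xor-true⁻ p p′ (proj₁ (∧-true⁻ (p xor p′) pp′)))
    where
    xor-true⁻ : ∀ p p′ → p xor p′ ≡ true → p ≡ not p′
    xor-true⁻ true  false _ = refl
    xor-true⁻ false true  _ = refl

  hom-G⇒hom-H : ∀ (F : Graph f) → (∃ λ g → g Preserves Adj F ⟶ _~ᵗ_ G) → Hom F H
  hom-G⇒hom-H F (g , g-pres) =
    let c , missed = missed-value (s≤s (≤-trans (m≤m+n f f) (m≤n+m (f + f) 2))) (position ∘ g)
    in  G→H c ∘ g , λ {x} {y} xy → G→H-pres c (g x) (g y) (missed x) (missed y) (g-pres xy)

  copies≤rex : ∀ (F : Graph f) → ¬ Hom F H → (2 * q) ^ h ≤ rex (length (vertices G)) H F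
  copies≤rex F no-hom = blowUp⇒rex G F H deg-G (no-hom ∘ hom-G⇒hom-H F) ι ι-injective ι∈ ι-pres
    where
    ι : Fin h × Fin (2 * q) → V G
    -- One of the `h` copies of `H` in `R` suffices; `a` is just an index at hand.
    ι (v , x) = inj₁ (inj₁ (v , a) , x)
    ι-injective : Injective _≡_ _≡_ ι
    ι-injective refl = refl
    ι∈ : ∀ vx → ι vx List.∈ vertices G
    ι∈ (v , x) = List.∈-++⁺ˡ (List.∈-map⁺ inj₁ (List.∈-cartesianProduct⁺
      (List.∈-++⁺ˡ (List.∈-map⁺ inj₁ (List.∈-cartesianProduct⁺ (List.∈-allFin v) (List.∈-allFin a))))
      (List.∈-allFin x)))
    ι-pres : ∀ i x j y → Adj H i j → _~ᵗ_ G (ι (i , x)) (ι (j , y))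
    ι-pres i x j y ij = cong₂ _∧_
      (cong₂ _∧_ (dec-true (adj? H i j) ij) (dec-true (a ≟ a) refl))
      (dec-true ((toℕ x + toℕ y) % (2 * q) <? 2 * q) (m%n<n (toℕ x + toℕ y) (2 * q)))

-- Reaching every large n

decompose : ∀ K e .{{_ : NonZero K}} → ∃₂ λ c n₀ → ∀ n → n₀ ≤ n →
  ∃ λ q → ∃₂ λ r k → NonZero q × n ≡ 2 * (K * q + e * r + k) + r × n ≤ c * q
-- The threshold makes `n / 2` at least `K + e`, hence `q` at least 1. Then `r`, `e * r` and the
-- remainder `k` are at most `q`, `e * q` and `K * q`, which adds up to the constant.
decompose K e = 1 + 2 * (2 * K + e) , 2 * (K + e) + 1 , λ n n₀≤n →
  let r = n % 2
      p = n / 2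
      s = p ∸ e * r
      q = s / K
      k = s % K
      r≤1 : r ≤ 1
      r≤1 = s≤s⁻¹ (m%n<n n 2)
      n≡ : n ≡ r + p * 2
      n≡ = m≡m%n+[m/n]*n n 2
      er≤e : e * r ≤ e
      er≤e = ≤-trans (*-monoʳ-≤ e r≤1) (≤-reflexive (*-identityʳ e))
      K+e≤p : K + e ≤ p
      K+e≤p = *-cancelˡ-≤ 2 (+-cancelʳ-≤ 1 _ _ (begin
        2 * (K + e) + 1 ≤⟨ n₀≤n ⟩
        n               ≡⟨ n≡ ⟩
        r + p * 2       ≤⟨ +-monoˡ-≤ (p * 2) r≤1 ⟩
        1 + p * 2       ≡⟨ trans (+-comm 1 (p * 2)) (cong (_+ 1) (*-comm p 2)) ⟩
        2 * p + 1       ∎))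
      p≡ : p ≡ e * r + (k + q * K)
      p≡ = trans (sym (m+[n∸m]≡n (≤-trans er≤e (≤-trans (m≤n+m e K) K+e≤p))))
                 (cong (e * r +_) (m≡m%n+[m/n]*n s K))
      K≤s : K ≤ s
      K≤s = begin
        K             ≡⟨ sym (m+n∸n≡m K e) ⟩
        K + e ∸ e     ≤⟨ ∸-mono K+e≤p er≤e ⟩
        s             ∎
      q>0 : 0 < q
      q>0 = m≥n⇒m/n>0 K≤s
  in  q , r , k , >-nonZero q>0
    , trans n≡ (trans (cong (λ p → r + p * 2) p≡) (arith K e q r k))
    , (begin
      n                                         ≡⟨ trans n≡ (cong (λ p → r + p * 2) p≡) ⟩
      r + (e * r + (k + q * K)) * 2
        ≤⟨ +-mono-≤ (≤-trans r≤1 q>0) (*-monoˡ-≤ 2 (+-mono-≤ (≤-trans er≤e (e≤e*q e q q>0))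
             (+-monoˡ-≤ (q * K) (≤-trans (m%n≤n s K) (e≤e*q K q q>0))))) ⟩
      q + (e * q + (K * q + q * K)) * 2         ≡⟨ collect K e q ⟩
      (1 + 2 * (2 * K + e)) * q                 ∎)
  where
  open ≤-Reasoning
  e≤e*q : ∀ e q → 0 < q → e ≤ e * q
  e≤e*q e q q>0 = m≤m*n e q {{>-nonZero q>0}}
  arith : ∀ K e q r k → r + (e * r + (k + q * K)) * 2 ≡ 2 * (K * q + e * r + k) + r
  arith = solve-∀
  collect : ∀ K e q → q + (e * q + (K * q + q * K)) * 2 ≡ (1 + 2 * (2 * K + e)) * q
  collect = solve-∀

^-distribʳ-* : ∀ a b h → (a * b) ^ h ≡ a ^ h * b ^ h
^-distribʳ-* a b zero    = refl
^-distribʳ-* a b (suc h) = trans (cong (a * b *_) (^-distribʳ-* a b h)) (interchange a b (a ^ h) (b ^ h))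
  where
  interchange : ∀ a b x y → a * b * (x * y) ≡ a * x * (b * y)
  interchange = solve-∀

power-bound : ∀ {n x} c m h → n ≤ c * m → m ^ h ≤ x → n ^ h ≤ c ^ h * x
power-bound {n} {x} c m h n≤cm m^h≤x = begin
  n ^ h           ≤⟨ ^-monoˡ-≤ h n≤cm ⟩
  (c * m) ^ h     ≡⟨ ^-distribʳ-* c m h ⟩
  c ^ h * m ^ h   ≤⟨ *-monoʳ-≤ (c ^ h) m^h≤x ⟩
  c ^ h * x       ∎
  where open ≤-Reasoning

no-hom⇒dense-edge : ∀ .{{_ : NonZero h}} (F : Graph f) (H : Graph h) {a b} → Adj H a b → ¬ Hom F H →
                    (λ n → n ^ h) =O (λ n → rex n H F)
no-hom⇒dense-edge {h} {f} F H {a} {b} ab no-hom =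
  let K = length (vertices (regularisation H)) + (2 * f + 5) * h
      c , n₀ , parts = decompose K (suc f)
        {{>-nonZero (<-≤-trans (>-nonZero⁻¹ ((2 * f + 5) * h) {{m*n≢0 (2 * f + 5) h {{2f+5≢0}}}}) (m≤n+m _ (length (vertices (regularisation H)))))}}
  in  c ^ h , n₀ , λ n n₀≤n →
    let q , r , k , q≢0 , n≡ , n≤cq = parts n n₀≤n
        open Construction H f ab q r k {{q≢0}}
    in power-bound c (2 * q) h (≤-trans n≤cq (*-monoʳ-≤ c (m≤m+n q (q + 0))))
         (subst (λ l → (2 * q) ^ h ≤ rex l H F) (trans length-G (sym n≡)) (copies≤rex F no-hom))
  where
  2f+5≢0 : NonZero (2 * f + 5)
  2f+5≢0 = >-nonZero (<-≤-trans z<s (m≤n+m 5 (2 * f)))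

edgeless : ℕ → ListGraph
edgeless n = record
  { vertices = allFin n
  ; _~_      = λ _ _ → false
  ; ~-sym    = λ _ _ → refl
  ; ~-irrefl = λ _ → refl
  }

-- `F` must have an edge, since otherwise a constant map would be a homomorphism; so the edgeless
-- graph is `F`-free. It contains the blow-up of the edgeless `H` with parts of size `n / h`.
no-hom⇒dense-edgeless : ∀ .{{_ : NonZero h}} (F : Graph f) (H : Graph h) → (∀ a b → ¬ Adj H a b) → ¬ Hom F H →
                        (λ n → n ^ h) =O (λ n → rex n H F)
no-hom⇒dense-edgeless {h} {f} F H empty no-hom = (2 * h) ^ h , h , λ n h≤n →
  power-bound (2 * h) (n / h) h (n≤ n h≤n)
    (subst (λ l → (n / h) ^ h ≤ rex l H F) (length-allFin n)
      (blowUp⇒rex (edgeless n) F H (λ _ → ∑-zero (allFin n))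
        (λ (_ , g-pres) → no-hom (no-edge⇒hom λ xy → case g-pres xy of λ ()))
        (λ (v , x) → inject≤ (Fin.combine v x) (h*[n/h]≤n n))
        (λ eq → cong₂-, (combine-injective _ _ _ _ (inject≤-injective _ _ _ _ eq)))
        (λ _ → List.∈-allFin _)
        (λ i _ j _ ij → contradiction ij (empty i j))))
  where
  open ≤-Reasoning
  cong₂-, : ∀ {A B : Set} {x y : A} {u v : B} → x ≡ y × u ≡ v → (x , u) ≡ (y , v)
  cong₂-, (refl , refl) = refl
  h*[n/h]≤n : ∀ n → h * (n / h) ≤ n
  h*[n/h]≤n n = ≤-trans (≤-reflexive (*-comm h (n / h))) (m/n*n≤m n h)
  no-edge⇒hom : (∀ {x y} → ¬ Adj F x y) → Hom F H
  no-edge⇒hom no-edge = (λ _ → Fin.fromℕ< (>-nonZero⁻¹ h)) , λ xy → contradiction xy no-edge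
  n≤ : ∀ n → h ≤ n → n ≤ 2 * h * (n / h)
  n≤ n h≤n = begin
    n                             ≡⟨ m≡m%n+[m/n]*n n h ⟩
    n % h + n / h * h             ≤⟨ +-monoˡ-≤ (n / h * h) (m%n≤n n h) ⟩
    h + n / h * h                 ≤⟨ +-monoˡ-≤ (n / h * h) (m≤n*m h (n / h) {{>-nonZero (m≥n⇒m/n>0 h≤n)}}) ⟩
    n / h * h + n / h * h         ≡⟨ collect (n / h) h ⟩
    2 * h * (n / h)               ∎
    where
    collect : ∀ m h → m * h + m * h ≡ 2 * h * m
    collect = solve-∀

no-hom⇒dense : ∀ .{{_ : NonZero h}} (F : Graph f) (H : Graph h) → ¬ Hom F H →
               (λ n → n ^ h) =O (λ n → rex n H F)
no-hom⇒dense F H no-hom with any? (λ a → any? (adj? H a))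
... | yes (a , b , ab) = no-hom⇒dense-edge F H ab no-hom
... | no  empty        = no-hom⇒dense-edgeless F H (λ a b ab → empty (a , b , ab)) no-hom

theorem1p2 : ∀ {f h : ℕ} .{{_ : NonZero h}} (F : Graph f) (H : Graph h) →
    ((λ n → rex n H F) =Θ (λ n → n ^ h))
    ⇔ (¬ (∃[ size ] Contains (BlowUp H size) (Adj F)))
theorem1p2 {f} {h} F H = mk⇔
  (λ (_ , dense) contained → hom⇒¬dense F H (contains⇒hom {F = F} {H} contained) dense)
  -- The upper half of Θ holds for all `F` and `H`, as there are only `n ^ h` tuples of vertices.
  (λ ¬contained → (1 , 0 , λ n _ → ≤-trans (rex≤n^h n H F) (≤-reflexive (sym (*-identityˡ (n ^ h)))))
                , no-hom⇒dense F H (λ hom → ¬contained (hom⇒contains {F = F} {H} hom)))
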